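{- Let $T$ be a tree of order $n \ge 3$ with maximum degree $\Delta$. Then \[ F_t(T) \le \frac{(\Delta - 1)n + 1}{\Delta}, \] with equality if and only if $T \in \mathcal{T}_{\Delta}$.
   Context: All graphs are finite, simple and undirected. Forcing process: given a graph $G$ and an initial set $S \subseteq V(G)$ of colored vertices, at each step a colored vertex that has exactly one non-colored neighbor forces (colors) that neighbor. $S$ is a forcing set if iterating this eventually colors all of $V(G)$. A total forcing set (TF-set) is a forcing set $S$ such that $G[S]$ has no isolated vertex; $F_t(G)$ is the minimum cardinality of a TF-set of $G$. A leaf is a vertex of degree $1$; a strong support vertex is a vertex adjacent to at least two leaves. The family $\mathcal{T}_{\Delta}$ consists of all trees $T$ with maximum degree $\Delta$ whose vertex set can be partitioned into sets $V_1,\ldots,V_k$ ($k\ge 1$) such that, with $T_i = T[V_i]$: (i) $T_1 \cong K_{1,\Delta}$, and if $k \ge 2$ then $T_i \cong K_{1,\Delta-1}$ for all $i \in \{2,\ldots,k\}$; (ii) for each $i$, the central vertex $v_i$ of the star $T_i$ (its non-leaf vertex) is a strong support vertex of degree $\Delta$ in $T$; (iii) $\{v_1,\ldots,v_k\}$ is an independent set in $T$. -}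

module Defs where

open import Data.Nat using (ℕ; zero; suc; _+_; _*_; _∸_; _≤_)
open import Data.Fin using (Fin; zero; suc; inject₁; fromℕ)
open import Data.Fin.Subset using (Subset; _∈_; ∣_∣)
open import Data.Vec using (tabulate)
open import Data.Bool using (Bool; true; false)
open import Data.Product using (Σ; ∃; _×_; _,_)
open import Relation.Binary.PropositionalEquality using (_≡_; _≢_)
open import Relation.Nullary using (¬_)
open import Function.Definitions using (Injective)

record Graph (n : ℕ) : Set where
  field
    adj     : Fin n → Fin n → Bool
    sym     : ∀ u v → adj u v ≡ adj v u
    irrefl  : ∀ v → adj v v ≡ false
open Graph public

Adj : ∀ {n} → Graph n → Fin n → Fin n → Set
Adj G u v = adj G u v ≡ true

nbhd : ∀ {n} → Graph n → Fin n → Subset n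
nbhd G v = tabulate (adj G v)

deg : ∀ {n} → Graph n → Fin n → ℕ
deg G v = ∣ nbhd G v ∣

MaxDegree : ∀ {n} → Graph n → ℕ → Set
MaxDegree G Δ = (∃ λ v → deg G v ≡ Δ) × (∀ v → deg G v ≤ Δ)

data Walk {n} (G : Graph n) : Fin n → Fin n → Set where
  nil  : ∀ {v} → Walk G v v
  cons : ∀ {u w v} → Adj G u w → Walk G w v → Walk G u v

Connected : ∀ {n} → Graph n → Set
Connected G = ∀ u v → Walk G u v

HasCycle : ∀ {n} → Graph n → Set
HasCycle {n} G =
  Σ ℕ λ j → Σ (Fin (suc (suc (suc j))) → Fin n) λ f →
    Injective _≡_ _≡_ f
    × (∀ (i : Fin (suc (suc j))) → Adj G (f (inject₁ i)) (f (suc i)))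
    × Adj G (f (fromℕ (suc (suc j)))) (f zero)

IsTree : ∀ {n} → Graph n → Set
IsTree G = Connected G × ¬ HasCycle G

-- forcing process: vertices eventually coloured starting from S
-- (the closure of S under the colour-change rule)
data Colored {n} (G : Graph n) (S : Subset n) : Fin n → Set where
  init  : ∀ {v} → v ∈ S → Colored G S v
  force : ∀ {u v} → Colored G S u → Adj G u v →
          (∀ w → Adj G u w → w ≢ v → Colored G S w) → Colored G S v

IsForcingSet : ∀ {n} → Graph n → Subset n → Set
IsForcingSet G S = ∀ v → Colored G S v

NoIsolatedIn : ∀ {n} → Graph n → Subset n → Set
NoIsolatedIn G S = ∀ v → v ∈ S → ∃ λ u → u ∈ S × Adj G v u

IsTFSet : ∀ {n} → Graph n → Subset n → Set
IsTFSet G S = IsForcingSet G S × NoIsolatedIn G S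

IsTotalForcingNumber : ∀ {n} → Graph n → ℕ → Set
IsTotalForcingNumber G k =
  (∃ λ S → IsTFSet G S × ∣ S ∣ ≡ k) × (∀ S → IsTFSet G S → k ≤ ∣ S ∣)

starAdj : ∀ {m} → Fin (suc m) → Fin (suc m) → Bool
starAdj zero    zero    = false
starAdj zero    (suc _) = true
starAdj (suc _) zero    = true
starAdj (suc _) (suc _) = false

InducedStar : ∀ {n k} → Graph n → (Fin n → Fin k) → Fin k → (m : ℕ) →
              (Fin (suc m) → Fin n) → Set
InducedStar {n} G part i m f =
  Injective _≡_ _≡_ f
  × (∀ a → part (f a) ≡ i)
  × (∀ v → part v ≡ i → ∃ λ a → f a ≡ v)
  × (∀ a b → adj G (f a) (f b) ≡ starAdj a b)

StrongSupport : ∀ {n} → Graph n → Fin n → Set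
StrongSupport G c = ∃ λ a → ∃ λ b → a ≢ b × Adj G c a × Adj G c b × deg G a ≡ 1 × deg G b ≡ 1

starSize : ∀ {k} → ℕ → Fin k → ℕ
starSize Δ zero    = Δ
starSize Δ (suc _) = Δ ∸ 1

-- the family 𝒯_Δ; parts V_i = {v | part v ≡ i} indexed by Fin (suc k'),
-- part zero plays the role of V_1; f i is an isomorphism K_{1,·} ≅ T[V_i],
-- and v_i = f i zero is the central vertex
InFamily : ∀ {n} → (Δ : ℕ) → Graph n → Set
InFamily {n} Δ T =
  IsTree T × MaxDegree T Δ ×
  Σ ℕ λ k' → Σ (Fin n → Fin (suc k')) λ part →
  Σ ((i : Fin (suc k')) → Fin (suc (starSize Δ i)) → Fin n) λ f →
    (∀ i → InducedStar T part i (starSize Δ i) (f i))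
    × (∀ i → StrongSupport T (f i zero) × deg T (f i zero) ≡ Δ)
    × (∀ i j → adj T (f i zero) (f j zero) ≡ false)

{-# OPTIONS --safe #-}
-- Root T at a vertex r of degree Δ. The complement of a set U is a total forcing set
-- as soon as r gets coloured, every vertex has at most one child in U, and no vertex outside U
-- has all its neighbours in U; the upper bound asks for such a U with Δ |U| ≥ n − 1.
-- Let every vertex pick at most one of its children for U, working upwards from the leaves.
-- The surplus of v is a lower bound for Δ times the number of picks in the subtree of v minus
-- the number of proper descendants of v. A pick gains Δ, and v has at most Δ − 1 children if
-- v ≠ r, so a vertex that can pick a child has positive surplus. A vertex of surplus 0 either
-- is a leaf or has only children of surplus exactly 1, and may then itself be picked.
-- Summing the surplus inequalities gives Δ |U| ≥ n − 1, with equality only if T is built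
-- from alternating layers of surplus 0 and of "hubs", which have degree Δ and two leaf
-- children: these hubs are the centres of the stars of 𝒯_Δ.
-- Conversely, the k centres of a member of 𝒯_Δ are independent of degree Δ, so they meet all
-- Δ k = n − 1 edges and lie in every TF-set S; hence only they force, and n − |S| ≤ k.
module Submission where

open import Defs
open import Data.Nat using (ℕ; zero; suc; _+_; _*_; _∸_; _≤_; _<_; _≥_; z≤n; s≤s; _≤?_)
open import Data.Nat.Properties
open import Data.Fin using (Fin; zero; suc; inject₁; fromℕ)
import Data.Fin.Properties as Fin
open import Data.Fin.Subset using (Subset; _∈_; ∣_∣)
open import Data.Fin.Subset.Properties using (_∈?_)
open import Data.Vec using (tabulate; lookup)
open import Data.Vec.Properties using (lookup∘tabulate; []=⇒lookup; lookup⇒[]=; tabulate∘lookup)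
open import Data.Bool using (Bool; true; false; not; _∧_; _∨_)
import Data.Bool.Properties as Bool
open import Data.Product using (∃; ∃₂; _×_; _,_; proj₁; proj₂)
open import Data.Sum using (_⊎_; inj₁; inj₂; swap)
open import Data.Maybe using (Maybe; just; nothing; maybe′)
open import Data.Maybe.Properties using (just-injective)
open import Data.Empty using (⊥; ⊥-elim)
open import Relation.Binary.PropositionalEquality
  using (_≡_; _≢_; refl; trans; cong; cong₂; subst; subst₂; module ≡-Reasoning)
  renaming (sym to ≡sym)
open import Relation.Nullary using (¬_; Dec; yes; no; does; contradiction)
open import Relation.Nullary.Decidable using (dec-true; dec-false; map′; _×-dec_; _→-dec_; _⊎-dec_; ¬?)
open import Function using (_∘_; case_of_)
open import Function.Definitions using (Injective)
open import Function.Bundles using (_⇔_; mk⇔)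
open import Algebra.Properties.CommutativeMonoid.Sum +-0-commutativeMonoid
  using (sum; sum-cong-≗; ∑-distrib-+; ∑-comm)
open import Algebra.Properties.Semiring.Sum +-*-semiring using (*-distribˡ-sum; *-distribʳ-sum)
open import Data.Nat.Tactic.RingSolver using (solve-∀)
open import Data.List using (List; []; _∷_; length)
import Data.List as List
import Data.List.Membership.Propositional as List
open import Data.List.Membership.Propositional.Properties using (∈-lookup)
open import Data.List.Relation.Unary.Any as Any using (here; there)
open import Data.List.Relation.Unary.All as All using (All)
open import Data.List.Relation.Unary.All.Properties using (¬Any⇒All¬)
open import Data.List.Relation.Unary.AllPairs using ([]; _∷_)
open import Data.List.Relation.Unary.Unique.Propositional using (Unique)
open import Relation.Binary.Construct.Closure.ReflexiveTransitive using (Star; ε; _◅_; _◅◅_)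

private variable n m : ℕ

-- Finite sums, indicator functions and counting.

⟦_⟧ : Bool → ℕ
⟦ true ⟧  = 1
⟦ false ⟧ = 0

true≢false : ∀ {b} → b ≡ true → b ≡ false → ⊥
true≢false refl ()

≢true⇒false : ∀ {b} → ¬ b ≡ true → b ≡ false
≢true⇒false = Bool.¬-not

∧-true : ∀ {a b} → a ∧ b ≡ true → a ≡ true × b ≡ true
∧-true {true} {true} _ = refl , refl

∨-true : ∀ {a b} → a ∨ b ≡ true → a ≡ true ⊎ b ≡ true
∨-true {true}  _ = inj₁ refl
∨-true {false} p = inj₂ p

bool-ext : ∀ {a b} → (a ≡ true → b ≡ true) → (b ≡ true → a ≡ true) → a ≡ b
bool-ext {true}  {b}     f g = ≡sym (f refl)
bool-ext {false} {true}  f g = g refl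
bool-ext {false} {false} f g = refl

does-true : ∀ {P : Set} (d : Dec P) → does d ≡ true → P
does-true (yes p) _ = p

opaque
  infix 5 _==_
  _==_ : Fin n → Fin n → Bool
  v == w = does (v Fin.≟ w)

  ==⇒≡ : {v w : Fin n} → (v == w) ≡ true → v ≡ w
  ==⇒≡ {v = v} {w} = does-true (v Fin.≟ w)

  ≡⇒== : {v w : Fin n} → v ≡ w → (v == w) ≡ true
  ≡⇒== {v = v} {w} = dec-true (v Fin.≟ w)

  ≢⇒== : {v w : Fin n} → v ≢ w → (v == w) ≡ false
  ≢⇒== {v = v} {w} = dec-false (v Fin.≟ w)

count : (Fin n → Bool) → ℕ
count P = sum (λ v → ⟦ P v ⟧)

sum-mono : {f g : Fin n → ℕ} → (∀ i → f i ≤ g i) → sum f ≤ sum g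
sum-mono {zero}  f≤g = z≤n
sum-mono {suc n} f≤g = +-mono-≤ (f≤g zero) (sum-mono (f≤g ∘ suc))

-- Slack at one index would have to be made up at another, which the termwise inequality forbids.
sum-tight : {f g : Fin n → ℕ} → (∀ i → f i ≤ g i) → sum g ≤ sum f → ∀ i → f i ≡ g i
sum-tight {suc n} {f} {g} f≤g Σg≤Σf = λ where
    zero    → ≤-antisym (f≤g zero) (+-cancelʳ-≤ _ _ _ (≤-trans Σg≤Σf (+-monoʳ-≤ (f zero) rest)))
    (suc i) → sum-tight (f≤g ∘ suc)
      (+-cancelˡ-≤ _ _ _ (≤-trans Σg≤Σf (+-monoˡ-≤ _ (f≤g zero)))) i
  where rest = sum-mono (f≤g ∘ suc)

sum-const : ∀ n c → sum {n} (λ _ → c) ≡ n * c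
sum-const zero    c = refl
sum-const (suc n) c = cong (c +_) (sum-const n c)

sum-zero : {f : Fin n → ℕ} → (∀ i → f i ≡ 0) → sum f ≡ 0
sum-zero {n} f≡0 = trans (sum-cong-≗ f≡0) (trans (sum-const n 0) (*-zeroʳ n))

term≤sum : (f : Fin n → ℕ) → ∀ i → f i ≤ sum f
term≤sum f zero    = m≤m+n _ _
term≤sum f (suc i) = ≤-trans (term≤sum (f ∘ suc) i) (m≤n+m _ _)

sum-single : (f : Fin n → ℕ) → ∀ i → (∀ j → j ≢ i → f j ≡ 0) → sum f ≡ f i
sum-single f zero    f≡0 = trans (cong (f zero +_) (sum-zero λ j → f≡0 (suc j) λ ())) (+-identityʳ _)
sum-single f (suc i) f≡0 =
  cong₂ _+_ (f≡0 zero λ ()) (sum-single (f ∘ suc) i λ j j≢i → f≡0 (suc j) (j≢i ∘ Fin.suc-injective))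

count-cong : {P Q : Fin n → Bool} → (∀ v → P v ≡ Q v) → count P ≡ count Q
count-cong P≡Q = sum-cong-≗ (λ v → cong ⟦_⟧ (P≡Q v))

count-none : (P : Fin n → Bool) → (∀ v → P v ≡ false) → count P ≡ 0
count-none _ none = sum-zero (λ v → cong ⟦_⟧ (none v))

count-≥1 : (P : Fin n → Bool) → ∀ {v} → P v ≡ true → 1 ≤ count P
count-≥1 P {v} Pv = ≤-trans (≤-reflexive (≡sym (cong ⟦_⟧ Pv))) (term≤sum (⟦_⟧ ∘ P) v)

count-one : (P : Fin n → Bool) → ∀ {v} → P v ≡ true → (∀ w → P w ≡ true → w ≡ v) → count P ≡ 1
count-one P {v} Pv unique =
  trans (sum-single (⟦_⟧ ∘ P) v λ w w≢v → cong ⟦_⟧ (≢true⇒false (w≢v ∘ unique w))) (cong ⟦_⟧ Pv)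

count-not : (P : Fin n → Bool) → count (not ∘ P) + count P ≡ n
count-not {n} P = trans (≡sym (∑-distrib-+ (⟦_⟧ ∘ not ∘ P) (⟦_⟧ ∘ P)))
  (trans (sum-cong-≗ (λ v → lemma (P v))) (trans (sum-const n 1) (*-identityʳ n)))
  where
  lemma : ∀ b → ⟦ not b ⟧ + ⟦ b ⟧ ≡ 1
  lemma true  = refl
  lemma false = refl

Enumerates : (Fin n → Bool) → ∀ {m} → (Fin m → Fin n) → Set
Enumerates P g = Injective _≡_ _≡_ g × (∀ a → P (g a) ≡ true) × (∀ v → P v ≡ true → ∃ λ a → g a ≡ v)

enumerate : (P : Fin n → Bool) → ∃ λ (g : Fin (count P) → Fin n) → Enumerates P g
enumerate {zero}  P = (λ ()) , (λ { {()} }) , (λ ()) , λ ()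
enumerate {suc n} P with P zero in P0 | enumerate (P ∘ suc)
... | true  | g , inj , sound , complete = g′ , inj′ , sound′ , complete′
  where
  g′ : Fin (suc _) → Fin (suc n)
  g′ zero    = zero
  g′ (suc a) = suc (g a)
  inj′ : Injective _≡_ _≡_ g′
  inj′ {zero}  {zero}  _ = refl
  inj′ {zero}  {suc b} ()
  inj′ {suc a} {zero}  ()
  inj′ {suc a} {suc b} p = cong suc (inj (Fin.suc-injective p))
  sound′ : ∀ a → P (g′ a) ≡ true
  sound′ zero    = P0
  sound′ (suc a) = sound a
  complete′ : ∀ v → P v ≡ true → ∃ λ a → g′ a ≡ v
  complete′ zero    _  = zero , refl
  complete′ (suc v) Pv = let a , ga≡v = complete v Pv in suc a , cong suc ga≡v
... | false | g , inj , sound , complete =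
  suc ∘ g , inj ∘ Fin.suc-injective , sound , complete′
  where
  complete′ : ∀ v → P v ≡ true → ∃ λ a → suc (g a) ≡ v
  complete′ zero    Pv = ⊥-elim (true≢false Pv P0)
  complete′ (suc v) Pv = let a , ga≡v = complete v Pv in a , cong suc ga≡v

-- Double counting of the pairs with `g a` equal to `v`: a vertex satisfying `P` is hit once and any
-- other never, while every index hits exactly one vertex.
count-enumerated : (P : Fin n → Bool) {g : Fin m → Fin n} → Enumerates P g → count P ≡ m
count-enumerated {n} {m} P {g} (inj , sound , complete) = begin
  count P                                 ≡⟨ sum-cong-≗ hits ⟨
  sum (λ v → count (λ a → g a == v))      ≡⟨ ∑-comm (λ v a → ⟦ g a == v ⟧) ⟩
  sum (λ a → count (λ v → g a == v))
    ≡⟨ sum-cong-≗ (λ a → count-one (g a ==_) (≡⇒== {v = g a} refl) (λ w p → ≡sym (==⇒≡ p))) ⟩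
  sum {m} (λ _ → 1)                       ≡⟨ sum-const m 1 ⟩
  m * 1                                   ≡⟨ *-identityʳ m ⟩
  m                                       ∎
  where
  open ≡-Reasoning
  hits : ∀ v → count (λ a → g a == v) ≡ ⟦ P v ⟧
  hits v with P v in Pv
  ... | true  = let a , ga≡v = complete v Pv in
    count-one (λ b → g b == v) (≡⇒== ga≡v) (λ b gb≡v → inj (trans (==⇒≡ gb≡v) (≡sym ga≡v)))
  ... | false = count-none (λ a → g a == v) (λ a → ≢⇒== λ ga≡v →
    true≢false (trans (cong P (≡sym ga≡v)) (sound a)) Pv)

enumerateAs : (P : Fin n → Bool) → count P ≡ m → ∃ λ (g : Fin m → Fin n) → Enumerates P g
enumerateAs P refl = enumerate P

count⇒∃ : (P : Fin n → Bool) → 1 ≤ count P → ∃ λ v → P v ≡ true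
count⇒∃ P 1≤ with count P | enumerate P
... | suc _ | g , _ , sound , _ = g zero , sound zero

count⇒∃₂ : (P : Fin n → Bool) → 2 ≤ count P → ∃₂ λ v w → v ≢ w × P v ≡ true × P w ≡ true
count⇒∃₂ P 2≤ with count P | enumerate P
count⇒∃₂ P (s≤s ()) | 1 | _
... | suc (suc _) | g , inj , sound , _ =
  g zero , g (suc zero) , (λ p → case inj p of λ ()) , sound zero , sound (suc zero)

∃₂⇒count : (P : Fin n → Bool) → ∀ {v w} → v ≢ w → P v ≡ true → P w ≡ true → 2 ≤ count P
∃₂⇒count P {v} {w} v≢w Pv Pw with count P | enumerate P
... | c | g , _ , _ , complete with complete v Pv | complete w Pw
∃₂⇒count P v≢w Pv Pw | 1 | g , _ | zero , p | zero , q = ⊥-elim (v≢w (trans (≡sym p) q))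
∃₂⇒count P v≢w Pv Pw | suc (suc _) | _ | _ | _ = s≤s (s≤s z≤n)

count-≤1 : (P : Fin n → Bool) → (∀ v w → P v ≡ true → P w ≡ true → v ≡ w) → count P ≤ 1
count-≤1 P unique with 2 ≤? count P
... | no  ¬2≤ = ≤-pred (≰⇒> ¬2≤)
... | yes 2≤  = let v , w , v≢w , Pv , Pw = count⇒∃₂ P 2≤ in ⊥-elim (v≢w (unique v w Pv Pw))

count-injection : (P : Fin n → Bool) (g : ∀ v → P v ≡ true → Fin m) →
  (∀ v w Pv Pw → g v Pv ≡ g w Pw → v ≡ w) → count P ≤ m
count-injection {n} {m} P g inj with count P | enumerate P
... | c | e , e-inj , sound , _ =
  Fin.injective⇒≤ {f = λ a → g (e a) (sound a)} (λ p → e-inj (inj _ _ _ _ p))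

∣tabulate∣ : (P : Fin n → Bool) → ∣ tabulate P ∣ ≡ count P
∣tabulate∣ {zero}  P = refl
∣tabulate∣ {suc n} P with P zero
... | true  = cong suc (∣tabulate∣ (P ∘ suc))
... | false = ∣tabulate∣ (P ∘ suc)

deg≡count : (G : Graph n) → ∀ v → deg G v ≡ count (adj G v)
deg≡count G v = ∣tabulate∣ (adj G v)

∈-tabulate⁺ : {P : Fin n → Bool} → ∀ {v} → P v ≡ true → v ∈ tabulate P
∈-tabulate⁺ {P = P} {v} Pv = lookup⇒[]= v _ (trans (lookup∘tabulate P v) Pv)

∈-tabulate⁻ : {P : Fin n → Bool} → ∀ {v} → v ∈ tabulate P → P v ≡ true
∈-tabulate⁻ {P = P} {v} v∈ = trans (≡sym (lookup∘tabulate P v)) ([]=⇒lookup v∈)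

≡true? : (b : Bool) → Dec (b ≡ true)
≡true? b = b Bool.≟ true

least : {P : ℕ → Set} → (∀ k → Dec (P k)) → ∀ m → P m → ∃ λ k → P k × (∀ j → P j → k ≤ j)
least P? zero    p = zero , p , λ _ _ → z≤n
least {P} P? (suc m) p with P? 0
... | yes p₀ = zero , p₀ , λ _ _ → z≤n
... | no ¬p₀ =
  let k , pk , min = least (P? ∘ suc) m p
  in suc k , pk , λ where
       zero    p₀ → contradiction p₀ ¬p₀
       (suc j) pj → s≤s (min j pj)

-- Simple paths, and the cycle closed by a chord.

lookup-injective : ∀ {A : Set} {xs : List A} → Unique xs → Injective _≡_ _≡_ (List.lookup xs)
lookup-injective (x∉ ∷ u) {zero}  {zero}  _ = refl
lookup-injective {xs = _ ∷ xs} (x∉ ∷ u) {zero}  {suc j} p = ⊥-elim (All.lookup x∉ (∈-lookup {xs = xs} j) p)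
lookup-injective {xs = _ ∷ xs} (x∉ ∷ u) {suc i} {zero}  p = ⊥-elim (All.lookup x∉ (∈-lookup {xs = xs} i) (≡sym p))
lookup-injective (x∉ ∷ u) {suc i} {suc j} p = cong suc (lookup-injective u p)

module _ (R : Fin n → Fin n → Set) where

  -- The list records every vertex of the walk, both ends included, so that simplicity becomes
  -- `Unique` of that list.
  data Chain : Fin n → Fin n → List (Fin n) → Set where
    single : ∀ {u} → Chain u u (u ∷ [])
    step   : ∀ {u w v xs} → R u w → Chain w v xs → Chain u v (u ∷ xs)

  -- Drops the part of the walk before its visit to `u`; this removes the loop that prepending `u`
  -- would create.
  truncate : ∀ {u w v xs} → Chain w v xs → Unique xs → u List.∈ xs → ∃ λ ys → Chain u v ys × Unique ys
  truncate c          u        (here refl) with c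
  ... | single   = _ , single , u
  ... | step r d = _ , step r d , u
  truncate (step _ c) (_ ∷ u) (there u∈)  = truncate c u u∈

  simple-chain : ∀ {u v} → Star R u v → ∃ λ xs → Chain u v xs × Unique xs
  simple-chain ε = _ , single , (All.[] ∷ [])
  simple-chain {u} (r ◅ rs) with simple-chain rs
  ... | xs , c , uniq with Any.any? (u Fin.≟_) xs
  ...   | yes u∈ = truncate c uniq u∈
  ...   | no  u∉ = _ , step r c , (¬Any⇒All¬ _ u∉ ∷ uniq)

  chain-last : ∀ {u v x xs} → Chain u v (x ∷ xs) → List.lookup (x ∷ xs) (fromℕ (length xs)) ≡ v
  chain-last single = refl
  chain-last (step _ single)       = refl
  chain-last (step _ c@(step _ _)) = chain-last c

  chain-step : ∀ {u v x xs} → Chain u v (x ∷ xs) → ∀ i →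
    R (List.lookup (x ∷ xs) (inject₁ i)) (List.lookup (x ∷ xs) (suc i))
  chain-step (step r single)       zero    = r
  chain-step (step r (step _ _))   zero    = r
  chain-step (step r c@(step _ _)) (suc i) = chain-step c i

  -- A simple `R`-path from `u` to `v` with at least three vertices closes up to a cycle of `G`
  -- through the edge `uv`. A shorter one has `u` equal to `v`, or is itself an `R`-edge.
  chord-in-subgraph : (G : Graph n) → ¬ HasCycle G → (∀ {u v} → R u v → Adj G u v) →
    ∀ {u v} → Adj G u v → Star R u v → ¬ ¬ R u v
  chord-in-subgraph G acyclic R⊆G {u} {v} uv walk ¬Ruv with simple-chain walk
  ... | _ , single , _               = true≢false uv (irrefl G u)
  ... | _ , step r single , _        = ¬Ruv r
  ... | x ∷ y ∷ z ∷ zs , c@(step _ (step _ d)) , uniq = acyclic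
    ( length zs , List.lookup (x ∷ y ∷ z ∷ zs) , lookup-injective uniq , (λ i → R⊆G (chain-step c i))
    , trans (cong (λ x → adj G x _) (chain-last {x = x} {xs = y ∷ z ∷ zs} c)) (trans (sym G _ _) uv))
  ... | _ ∷ _ ∷ [] , step _ (step _ ()) , _

-- Rooted trees given by a parent function.

data ParentEdge {n : ℕ} (par : Fin n → Fin n) (r : Fin n) : Fin n → Fin n → Set where
  up   : ∀ {v} → v ≢ r → ParentEdge par r v (par v)
  down : ∀ {v} → v ≢ r → ParentEdge par r (par v) v

-- The value `par r` is arbitrary, hence the guards `v ≢ r`. The rank only has to grow from parent
-- to child; it serves as the measure for inductions in both directions.
record Rooted {n} (G : Graph n) (r : Fin n) : Set where
  field
    par       : Fin n → Fin n
    rank      : Fin n → ℕ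
    par-adj   : ∀ v → v ≢ r → Adj G (par v) v
    par-rank  : ∀ v → v ≢ r → rank (par v) < rank v
    edge-par  : ∀ {u v} → Adj G u v → (v ≢ r × par v ≡ u) ⊎ (u ≢ r × par u ≡ v)

  nonroot : Fin n → Bool
  nonroot v = not (v == r)

  child : Fin n → Fin n → Bool
  child v w = nonroot w ∧ (par w == v)

  nonroot⇒≢ : ∀ {v} → nonroot v ≡ true → v ≢ r
  nonroot⇒≢ {v} nr v≡r = true≢false nr (cong not (≡⇒== v≡r))

  ≢⇒nonroot : ∀ {v} → v ≢ r → nonroot v ≡ true
  ≢⇒nonroot v≢r = cong not (≢⇒== v≢r)

  child⇒≢r : ∀ {v w} → child v w ≡ true → w ≢ r
  child⇒≢r p = nonroot⇒≢ (proj₁ (∧-true p))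

  child⇒par : ∀ {v w} → child v w ≡ true → par w ≡ v
  child⇒par p = ==⇒≡ (proj₂ (∧-true p))

  mk-child : ∀ {v w} → w ≢ r → par w ≡ v → child v w ≡ true
  mk-child w≢r eq = cong₂ _∧_ (≢⇒nonroot w≢r) (≡⇒== eq)

  par-child : ∀ {w} → w ≢ r → child (par w) w ≡ true
  par-child w≢r = mk-child w≢r refl

  child-adj : ∀ {v w} → child v w ≡ true → Adj G v w
  child-adj {v} {w} p = subst (λ u → Adj G u w) (child⇒par p) (par-adj w (child⇒≢r p))

  child-rank : ∀ {v w} → child v w ≡ true → rank v < rank w
  child-rank {v} {w} p = subst (λ u → rank u < rank w) (child⇒par p) (par-rank w (child⇒≢r p))

  adj⇒child : ∀ {u v} → Adj G u v → child u v ≡ true ⊎ child v u ≡ true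
  adj⇒child uv with edge-par uv
  ... | inj₁ (v≢r , p) = inj₁ (mk-child v≢r p)
  ... | inj₂ (u≢r , p) = inj₂ (mk-child u≢r p)

  -- The two summands are never both 1, because the rank would have to grow both ways.
  ⟦adj⟧ : ∀ u v → ⟦ adj G u v ⟧ ≡ ⟦ child u v ⟧ + ⟦ child v u ⟧
  ⟦adj⟧ u v with child u v in p | child v u in q
  ... | true  | true  = ⊥-elim (<-asym (child-rank p) (child-rank q))
  ... | true  | false = cong ⟦_⟧ (child-adj p)
  ... | false | true  = cong ⟦_⟧ (trans (sym G u v) (child-adj q))
  ... | false | false = cong ⟦_⟧ (≢true⇒false λ uv → case adj⇒child uv of λ where
    (inj₁ p′) → true≢false p′ p
    (inj₂ q′) → true≢false q′ q)

  parents : ∀ w → count (λ u → child u w) ≡ ⟦ nonroot w ⟧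
  parents w with w Fin.≟ r
  ... | yes w≡r = trans (count-none (λ u → child u w) (λ u → ≢true⇒false λ p → child⇒≢r p w≡r))
                        (≡sym (cong (λ b → ⟦ not b ⟧) (≡⇒== w≡r)))
  ... | no  w≢r = trans (count-one (λ u → child u w) (par-child w≢r) (λ u p → ≡sym (child⇒par p)))
                        (≡sym (cong ⟦_⟧ (≢⇒nonroot w≢r)))

  deg≡children : ∀ v → deg G v ≡ count (child v) + ⟦ nonroot v ⟧
  deg≡children v = begin
    deg G v                                       ≡⟨ deg≡count G v ⟩
    count (adj G v)                               ≡⟨ sum-cong-≗ (⟦adj⟧ v) ⟩
    sum (λ w → ⟦ child v w ⟧ + ⟦ child w v ⟧)      ≡⟨ ∑-distrib-+ (λ w → ⟦ child v w ⟧) _ ⟩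
    count (child v) + count (λ w → child w v)     ≡⟨ cong (count (child v) +_) (parents v) ⟩
    count (child v) + ⟦ nonroot v ⟧               ∎
    where open ≡-Reasoning

  count-nonroot : count nonroot + 1 ≡ n
  count-nonroot = trans (cong (count nonroot +_) (≡sym (count-one (_== r) (≡⇒== {v = r} refl) (λ _ → ==⇒≡))))
                        (count-not (_== r))

  -- Every vertex except the root is a child of exactly one vertex, so exchanging the sums counts it
  -- once.
  ∑-children : (h : Fin n → ℕ) →
    sum (λ v → sum (λ w → ⟦ child v w ⟧ * h w)) ≡ sum (λ w → ⟦ nonroot w ⟧ * h w)
  ∑-children h = begin
    sum (λ v → sum (λ w → ⟦ child v w ⟧ * h w))  ≡⟨ ∑-comm (λ v w → ⟦ child v w ⟧ * h w) ⟩
    sum (λ w → sum (λ v → ⟦ child v w ⟧ * h w))  ≡⟨ sum-cong-≗ (λ w → *-distribʳ-sum (h w) (λ v → ⟦ child v w ⟧)) ⟨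
    sum (λ w → count (λ v → child v w) * h w)    ≡⟨ sum-cong-≗ (λ w → cong (_* h w) (parents w)) ⟩
    sum (λ w → ⟦ nonroot w ⟧ * h w)              ∎
    where open ≡-Reasoning

-- Rooting a tree at a given vertex.

module _ {n} (G : Graph n) (r : Fin n) where

  -- Walks from `r` with exactly `k` edges; the least such `k` is the distance from `r`.
  Reach : ℕ → Fin n → Set
  Reach zero    v = v ≡ r
  Reach (suc k) v = ∃ λ u → Reach k u × Adj G u v

  reach? : ∀ k v → Dec (Reach k v)
  reach? zero    v = v Fin.≟ r
  reach? (suc k) v = Fin.any? (λ u → reach? k u ×-dec ≡true? (adj G u v))

  reach-walk : ∀ {u v} k → Reach k u → Walk G u v → ∃ λ m → Reach m v
  reach-walk k ru nil         = k , ru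
  reach-walk k ru (cons uw p) = reach-walk (suc k) (_ , ru , uw) p

  -- Breadth-first search from r; acyclicity rules out edges outside the search tree.
  root-tree : IsTree G → Rooted G r
  root-tree (connected , acyclic) = record
    { par      = par
    ; rank     = rank
    ; par-adj  = λ v v≢r → proj₁ (par-spec v v≢r)
    ; par-rank = λ v v≢r → proj₂ (par-spec v v≢r)
    ; edge-par = edge-par
    }
    where
    nearest : ∀ v → ∃ λ k → Reach k v × (∀ j → Reach j v → k ≤ j)
    nearest v = let m , rm = reach-walk 0 refl (connected r v) in least (λ k → reach? k v) m rm

    rank : Fin n → ℕ
    rank v = proj₁ (nearest v)

    parent : ∀ v → ∃ λ u → v ≢ r → Adj G u v × rank u < rank v
    parent v with nearest v
    ... | zero  , v≡r          , _ = v , λ v≢r → contradiction v≡r v≢r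
    -- The last vertex before `v` on a shortest walk is reached in `k` steps, so its own distance is
    -- at most `k`.
    ... | suc k , (u , ru , uv) , _ = u , λ _ → uv , s≤s (proj₂ (proj₂ (nearest u)) k ru)

    par : Fin n → Fin n
    par v = proj₁ (parent v)

    par-spec : ∀ v → v ≢ r → Adj G (par v) v × rank (par v) < rank v
    par-spec v = proj₂ (parent v)

    TreeEdge : Fin n → Fin n → Set
    TreeEdge = ParentEdge par r

    -- The strict bound `k` on the rank is the fuel: each step to the parent lowers the rank.
    to-root : ∀ k v → rank v < k → Star TreeEdge v r × Star TreeEdge r v
    to-root (suc k) v v<k with v Fin.≟ r
    ... | yes refl = ε , ε
    ... | no v≢r =
      let p , q = to-root k (par v) (≤-trans (proj₂ (par-spec v v≢r)) (≤-pred v<k))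
      in up v≢r ◅ p , q ◅◅ (down v≢r ◅ ε)

    tree⊆G : ∀ {u v} → TreeEdge u v → Adj G u v
    tree⊆G (up {v} v≢r)   = trans (sym G v (par v)) (proj₁ (par-spec v v≢r))
    tree⊆G (down {v} v≢r) = proj₁ (par-spec v v≢r)

    edge-par : ∀ {u v} → Adj G u v → (v ≢ r × par v ≡ u) ⊎ (u ≢ r × par u ≡ v)
    edge-par {u} {v} uv
      with ¬? (v Fin.≟ r) ×-dec (par v Fin.≟ u) | ¬? (u Fin.≟ r) ×-dec (par u Fin.≟ v)
    ... | yes p | _     = inj₁ p
    ... | no ¬p | yes q = inj₂ q
    -- The edge would be a chord of the tree walk from `u` up to `r` and down to `v`.
    ... | no ¬p | no ¬q = ⊥-elim (chord-in-subgraph TreeEdge G acyclic tree⊆G uv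
        (proj₁ (to-root _ u ≤-refl) ◅◅ proj₂ (to-root _ v ≤-refl))
        λ { (up u≢r) → ¬q (u≢r , refl) ; (down v≢r) → ¬p (v≢r , refl) })

-- Types of vertices, computed from the leaves upwards.

-- Leaves and branches have surplus 0 and may be picked; hubs have surplus exactly 1, rich
-- vertices at least 2, and free vertices at least 1 but may also be picked.
data Ty : Set where
  leaf branch hub rich free : Ty

-- An injection into `Fin 5`, from which decidable equality of types is transported.
code : Ty → Fin 5
code leaf   = zero
code branch = suc zero
code hub    = suc (suc zero)
code rich   = suc (suc (suc zero))
code free   = suc (suc (suc (suc zero)))

decode : Fin 5 → Ty
decode zero                         = leaf
decode (suc zero)                   = branch
decode (suc (suc zero))             = hub
decode (suc (suc (suc zero)))       = rich
decode (suc (suc (suc (suc zero)))) = free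

decode-code : ∀ t → decode (code t) ≡ t
decode-code leaf   = refl
decode-code branch = refl
decode-code hub    = refl
decode-code rich   = refl
decode-code free   = refl

_≟ᵗ_ : (s t : Ty) → Dec (s ≡ t)
s ≟ᵗ t = map′ (λ p → trans (≡sym (decode-code s)) (trans (cong decode p) (decode-code t))) (cong code)
              (code s Fin.≟ code t)

is : Ty → Ty → Bool
is s t = does (s ≟ᵗ t)

is⇒≡ : ∀ {s t} → is s t ≡ true → s ≡ t
is⇒≡ {s} {t} = does-true (s ≟ᵗ t)

≡⇒is : ∀ {s t} → s ≡ t → is s t ≡ true
≡⇒is {s} {t} = dec-true (s ≟ᵗ t)

surplus : Ty → ℕ
surplus leaf   = 0
surplus branch = 0
surplus hub    = 1
surplus rich   = 2
surplus free   = 1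

-- l, m, a, c, d count the children of type leaf, branch, hub, rich, free.
data Spec (cap l m a c d : ℕ) : Ty → Set where
  leaf      : l + m + a + c + d ≡ 0 → Spec cap l m a c d leaf
  branch    : l + m + d ≡ 0 → c ≡ 0 → 1 ≤ a → Spec cap l m a c d branch
  hub       : 2 ≤ l → cap ≤ l + m → Spec cap l m a c d hub
  rich      : 1 ≤ l + m + d → 2 ≤ l + m + a + c + d → l + m < cap → Spec cap l m a c d rich
  free-none : l + m + d ≡ 0 → 1 ≤ c → Spec cap l m a c d free
  free-only : 1 ≤ l + m + d → l + m + a + c + d ≡ 1 → Spec cap l m a c d free
  free-full : 1 ≤ l + m + d → 2 ≤ l + m + a + c + d → l ≤ 1 → cap ≤ l + m → Spec cap l m a c d free

-- If no child may be picked, a rich child gives `free`, failing that a hub child gives `branch`,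
-- and otherwise there are no children. If some child may be picked, the questions in order are
-- whether it is the only child, whether leaves and branches fill the capacity, and whether two
-- children are leaves.
classify : ∀ cap l m a c d → ∃ (Spec cap l m a c d)
classify cap l m a c d with 1 ≤? l + m + d
... | no ¬p with n<1⇒n≡0 (≰⇒> ¬p)
...   | none with 1 ≤? c | 1 ≤? a
...     | yes 1≤c | _       = free , free-none none 1≤c
...     | no ¬c   | yes 1≤a = branch , branch none (n<1⇒n≡0 (≰⇒> ¬c)) 1≤a
...     | no ¬c   | no ¬a   = leaf , leaf (trans (regroup l m a c d)
  (cong₂ _+_ (cong₂ _+_ none (n<1⇒n≡0 (≰⇒> ¬a))) (n<1⇒n≡0 (≰⇒> ¬c))))
  where
  regroup : ∀ l m a c d → l + m + a + c + d ≡ l + m + d + a + c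
  regroup = solve-∀
classify cap l m a c d | yes p with 2 ≤? l + m + a + c + d | cap ≤? l + m | 2 ≤? l
... | no ¬2  | _     | _     = free , free-only p (≤-antisym (≤-pred (≰⇒> ¬2)) (≤-trans p (le l m a c d)))
  where
  regroup : ∀ l m a c d → l + m + d + (a + c) ≡ l + m + a + c + d
  regroup = solve-∀
  le : ∀ l m a c d → l + m + d ≤ l + m + a + c + d
  le l m a c d = subst (l + m + d ≤_) (regroup l m a c d) (m≤m+n _ _)
... | yes 2≤ | no ¬q | _     = rich , rich p 2≤ (≰⇒> ¬q)
... | yes 2≤ | yes q | yes h = hub , hub h q
... | yes 2≤ | yes q | no ¬h = free , free-full p 2≤ (≤-pred (≰⇒> ¬h)) q

sum-+₅ : (f g h i j : Fin n → ℕ) →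
  sum (λ v → f v + g v + h v + i v + j v) ≡ sum f + sum g + sum h + sum i + sum j
sum-+₅ f g h i j =
  trans (∑-distrib-+ (λ v → f v + g v + h v + i v) j) (cong (_+ sum j)
  (trans (∑-distrib-+ (λ v → f v + g v + h v) i) (cong (_+ sum i)
  (trans (∑-distrib-+ (λ v → f v + g v) h) (cong (_+ sum h)
  (∑-distrib-+ f g))))))

module Typing {n} (G : Graph n) (r : Fin n) (R : Rooted G r) (cap : Fin n → ℕ) where
  open Rooted R

  kids : (Fin n → Ty) → Fin n → Ty → ℕ
  kids τ v t = count (λ w → child v w ∧ is (τ w) t)

  kids-cong : ∀ {τ τ′} v → (∀ w → child v w ≡ true → τ w ≡ τ′ w) → ∀ t → kids τ v t ≡ kids τ′ v t
  kids-cong {τ} {τ′} v eq t = count-cong lemma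
    where
    lemma : ∀ w → (child v w ∧ is (τ w) t) ≡ (child v w ∧ is (τ′ w) t)
    lemma w with child v w in p
    ... | true  = cong (λ s → is s t) (eq w p)
    ... | false = refl


  TypeSpec : (Fin n → Ty) → Fin n → Ty → Set
  TypeSpec τ v = Spec (cap v) (kids τ v leaf) (kids τ v branch) (kids τ v hub) (kids τ v rich) (kids τ v free)

  retype : (Fin n → Ty) → Fin n → Ty
  retype τ v = proj₁ (classify (cap v) (kids τ v leaf) (kids τ v branch) (kids τ v hub) (kids τ v rich) (kids τ v free))

  retype-cong : ∀ {τ τ′} v → (∀ w → child v w ≡ true → τ w ≡ τ′ w) → retype τ v ≡ retype τ′ v
  retype-cong {τ} {τ′} v eq
    rewrite kids-cong v eq leaf | kids-cong v eq branch | kids-cong v eq hub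
          | kids-cong v eq rich | kids-cong v eq free = refl

  -- The recursion over subtrees is replaced by rounds of simultaneous retyping, started from an
  -- arbitrary constant.
  approx : ℕ → Fin n → Ty
  approx zero    = λ _ → leaf
  approx (suc k) = retype (approx k)

  height : ℕ
  height = suc (sum rank)

  -- A type depends on the children only, and these have larger rank, so after `k` rounds all
  -- vertices of rank at least `height` minus `k` are settled. In the base case there is no such
  -- vertex, as `height` exceeds every rank.
  approx-stable : ∀ k v → height ≤ rank v + k → approx (suc k) v ≡ approx k v
  approx-stable zero v h≤ = contradiction (term≤sum rank v)
    (<⇒≱ (subst (height ≤_) (+-identityʳ _) h≤))
  approx-stable (suc k) v h≤ = retype-cong v λ w vw → approx-stable k w
    (≤-trans (subst (height ≤_) (+-suc _ _) h≤) (+-monoˡ-≤ k (child-rank vw)))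

  opaque
    -- Opaque, so that later arguments rest on `type-spec` and not on the iteration.
    type : Fin n → Ty
    type = approx height

    type-spec : ∀ v → TypeSpec type v (type v)
    type-spec v = subst (TypeSpec type v) (approx-stable height v (m≤n+m _ _)) (proj₂ (classify _ _ _ _ _ _))

  #_of_ : Ty → Fin n → ℕ
  # t of v = kids type v t

  has⇒# : ∀ {v w t} → child v w ≡ true → type w ≡ t → 1 ≤ # t of v
  has⇒# {v} {w} {t} vw tw = count-≥1 (λ w → child v w ∧ is (type w) t) {w} (cong₂ _∧_ vw (≡⇒is tw))

  #⇒has : ∀ {v t} → 1 ≤ # t of v → ∃ λ w → child v w ≡ true × type w ≡ t
  #⇒has {v} {t} 1≤ with count⇒∃ _ 1≤
  ... | w , p = let q , s = ∧-true {child v w} p in w , q , is⇒≡ s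

  -- Splits the contribution of one child by its type: exactly one of the five indicators survives
  -- when `b` holds.
  weigh : (g : Ty → ℕ) (b : Bool) (t : Ty) → ⟦ b ⟧ * g t ≡
    g leaf * ⟦ b ∧ is t leaf ⟧ + g branch * ⟦ b ∧ is t branch ⟧ + g hub * ⟦ b ∧ is t hub ⟧
    + g rich * ⟦ b ∧ is t rich ⟧ + g free * ⟦ b ∧ is t free ⟧
  weigh g false t = zeros (g leaf) (g branch) (g hub) (g rich) (g free)
    where
    zeros : ∀ l m a c d → 0 ≡ l * 0 + m * 0 + a * 0 + c * 0 + d * 0
    zeros = solve-∀
  weigh g true leaf = lemma (g leaf) (g branch) (g hub) (g rich) (g free)
    where
    lemma : ∀ l m a c d → 1 * l ≡ l * 1 + m * 0 + a * 0 + c * 0 + d * 0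
    lemma = solve-∀
  weigh g true branch = lemma (g leaf) (g branch) (g hub) (g rich) (g free)
    where
    lemma : ∀ l m a c d → 1 * m ≡ l * 0 + m * 1 + a * 0 + c * 0 + d * 0
    lemma = solve-∀
  weigh g true hub = lemma (g leaf) (g branch) (g hub) (g rich) (g free)
    where
    lemma : ∀ l m a c d → 1 * a ≡ l * 0 + m * 0 + a * 1 + c * 0 + d * 0
    lemma = solve-∀
  weigh g true rich = lemma (g leaf) (g branch) (g hub) (g rich) (g free)
    where
    lemma : ∀ l m a c d → 1 * c ≡ l * 0 + m * 0 + a * 0 + c * 1 + d * 0
    lemma = solve-∀
  weigh g true free = lemma (g leaf) (g branch) (g hub) (g rich) (g free)
    where
    lemma : ∀ l m a c d → 1 * d ≡ l * 0 + m * 0 + a * 0 + c * 0 + d * 1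
    lemma = solve-∀

  sum-by-type : (g : Ty → ℕ) → ∀ v → sum (λ w → ⟦ child v w ⟧ * g (type w)) ≡
    g leaf * # leaf of v + g branch * # branch of v + g hub * # hub of v
    + g rich * # rich of v + g free * # free of v
  sum-by-type g v = begin
    sum (λ w → ⟦ child v w ⟧ * g (type w))
      ≡⟨ sum-cong-≗ (λ w → weigh g (child v w) (type w)) ⟩
    sum (λ w → term leaf w + term branch w + term hub w + term rich w + term free w)
      ≡⟨ sum-+₅ (term leaf) (term branch) (term hub) (term rich) (term free) ⟩
    sum (term leaf) + sum (term branch) + sum (term hub) + sum (term rich) + sum (term free)
      ≡⟨ cong₂ _+_ (cong₂ _+_ (cong₂ _+_ (cong₂ _+_ (total leaf) (total branch)) (total hub)) (total rich)) (total free) ⟩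
    _ ∎
    where
    open ≡-Reasoning
    term : Ty → Fin n → ℕ
    term t w = g t * ⟦ child v w ∧ is (type w) t ⟧
    total : ∀ t → sum (term t) ≡ g t * # t of v
    total t = ≡sym (*-distribˡ-sum (g t) (λ w → ⟦ child v w ∧ is (type w) t ⟧))

  #children : ∀ v → count (child v) ≡
    # leaf of v + # branch of v + # hub of v + # rich of v + # free of v
  #children v = begin
    count (child v)                 ≡⟨ sum-cong-≗ (λ w → ≡sym (*-identityʳ ⟦ child v w ⟧)) ⟩
    sum (λ w → ⟦ child v w ⟧ * 1)   ≡⟨ sum-by-type (λ _ → 1) v ⟩
    _                               ≡⟨ ones (# leaf of v) (# branch of v) (# hub of v) (# rich of v) (# free of v) ⟩
    _ ∎
    where
    open ≡-Reasoning
    ones : ∀ l m a c d → 1 * l + 1 * m + 1 * a + 1 * c + 1 * d ≡ l + m + a + c + d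
    ones = solve-∀

  #surplus : ∀ v → sum (λ w → ⟦ child v w ⟧ * surplus (type w)) ≡
    # hub of v + 2 * # rich of v + # free of v
  #surplus v = trans (sum-by-type surplus v) (lemma (# leaf of v) (# branch of v) (# hub of v) (# rich of v) (# free of v))
    where
    lemma : ∀ l m a c d → 0 * l + 0 * m + 1 * a + 2 * c + 1 * d ≡ a + 2 * c + d
    lemma = solve-∀

-- The surplus inequality at a single vertex.

full⇒others-none : ∀ {cap} l m a c d → l + m + a + c + d ≤ cap → cap ≤ l + m → a ≡ 0 × c ≡ 0 × d ≡ 0
full⇒others-none l m a c d total≤cap cap≤ = m+n≡0⇒m≡0 a (m+n≡0⇒m≡0 (a + c) a+c+d≡0) , m+n≡0⇒n≡0 a (m+n≡0⇒m≡0 (a + c) a+c+d≡0)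
                      , m+n≡0⇒n≡0 (a + c) a+c+d≡0
  where
  assoc : ∀ l m a c d → l + m + a + c + d ≡ l + m + (a + c + d)
  assoc = solve-∀
  a+c+d≡0 : a + c + d ≡ 0
  a+c+d≡0 = n≤0⇒n≡0 (+-cancelˡ-≤ (l + m) _ _ (subst₂ _≤_ (assoc l m a c d) (≡sym (+-identityʳ _))
    (≤-trans total≤cap cap≤)))

module _ {Δ cap l m a c d} (2≤Δ : 2 ≤ Δ)
         (total≤cap : l + m + a + c + d ≤ cap) {p : ℕ} (picks : 1 ≤ l + m + d → p ≡ 1) where

  private
    l+m≤l+m+d : l + m ≤ l + m + d
    l+m≤l+m+d = m≤m+n _ d

    l+m≤total : l + m ≤ l + m + a + c + d
    l+m≤total = ≤-trans (m≤m+n _ a) (≤-trans (m≤m+n _ c) (m≤m+n _ d))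

    picked : ∀ {x} → 1 ≤ l + m + d → x ≤ Δ → x ≤ Δ * p + c
    picked 1≤ x≤Δ = ≤-trans x≤Δ (≤-trans
      (≤-reflexive (≡sym (trans (cong (Δ *_) (picks 1≤)) (*-identityʳ Δ)))) (m≤m+n _ c))

    unpicked : l + m + d ≡ 0 → ∀ e {x} → e ≤ x → e + (l + m) ≤ x
    unpicked ≡0 e {x} e≤x = subst (λ y → e + y ≤ x)
      (≡sym (n≤0⇒n≡0 (subst (l + m ≤_) ≡0 l+m≤l+m+d))) (subst (_≤ x) (≡sym (+-identityʳ e)) e≤x)

    some : 2 ≤ l → 1 ≤ l + m + d
    some 2≤l = ≤-trans (≤-trans (n≤1+n 1) 2≤l) (≤-trans (m≤m+n l m) l+m≤l+m+d)

    -- Each child costs 1 as a descendant. Hub and free children pay for themselves with surplus 1,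
    -- a rich child leaves 1 over, and leaves and branches remain to be paid for.
    regroup : ∀ s → s + (l + m) ≤ Δ * p + c →
      s + (l + m + a + c + d) ≤ Δ * p + (a + 2 * c + d)
    regroup s le = subst₂ _≤_ (lhs s l m a c d) (rhs (Δ * p) a c d) (+-monoˡ-≤ (a + c + d) le)
      where
      lhs : ∀ s l m a c d → s + (l + m) + (a + c + d) ≡ s + (l + m + a + c + d)
      lhs = solve-∀
      rhs : ∀ x a c d → x + c + (a + c + d) ≡ x + (a + 2 * c + d)
      rhs = solve-∀

  -- Away from the root the capacity is `Δ` minus 1. A pick earns `Δ`, so after paying for leaves
  -- and branches at least 1 is left, and 2 if they do not fill the capacity. Without a pick there
  -- are none to pay for, and a rich child supplies the surplus of `free-none`.
  gain : ∀ {t} → Spec cap l m a c d t → suc cap ≡ Δ → surplus t + (l + m + a + c + d) ≤ Δ * p + (a + 2 * c + d)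
  gain {t} spec refl = regroup (surplus t) (go spec)
    where
    go : Spec cap l m a c d t → surplus t + (l + m) ≤ Δ * p + c
    go (leaf ≡0)                 = ≤-trans l+m≤total (subst (_≤ Δ * p + c) (≡sym ≡0) z≤n)
    go (branch ≡0 _ _)           = unpicked ≡0 0 z≤n
    go (hub 2≤l _)               = picked (some 2≤l) (s≤s (≤-trans l+m≤total total≤cap))
    go (rich 1≤ _ l+m<cap)       = picked 1≤ (s≤s l+m<cap)
    go (free-none ≡0 1≤c)        = unpicked ≡0 1 (≤-trans 1≤c (m≤n+m c _))
    go (free-only 1≤ total≡1)    =
      picked 1≤ (≤-trans (s≤s (subst (l + m ≤_) total≡1 l+m≤total)) 2≤Δ)
    go (free-full 1≤ _ _ _)      = picked 1≤ (s≤s (≤-trans l+m≤total total≤cap))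

  -- At the root the capacity is `Δ` itself, so a unit of surplus may be lost. A margin of 1
  -- survives in `strict`; in `improvable` it is regained later by uncolouring the root as well;
  -- `tight` leaves room for equality.
  data RootKind (t : Ty) : Set where
    tight  : t ≡ branch ⊎ t ≡ hub → l + m + a + c + d ≤ Δ * p + (a + 2 * c + d) → RootKind t
    strict : 1 + (l + m + a + c + d) ≤ Δ * p + (a + 2 * c + d) → RootKind t
    improvable : t ≡ free → l ≤ 1 → cap ≤ l + m →
             l + m + a + c + d ≤ Δ * p + (a + 2 * c + d) → RootKind t

  root-kind : ∀ {t} → Spec cap l m a c d t → cap ≡ Δ → 1 ≤ l + m + a + c + d → RootKind t
  root-kind spec refl 1≤total with spec
  ... | leaf ≡0               = contradiction (subst (1 ≤_) ≡0 1≤total) λ ()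
  ... | branch ≡0 _ _         = tight (inj₁ refl) (regroup 0 (unpicked ≡0 0 z≤n))
  ... | hub 2≤l _             = tight (inj₂ refl) (regroup 0 (picked (some 2≤l) (≤-trans l+m≤total total≤cap)))
  ... | rich 1≤ _ l+m<cap     = strict (regroup 1 (picked 1≤ l+m<cap))
  ... | free-none ≡0 1≤c      = strict (regroup 1 (unpicked ≡0 1 (≤-trans 1≤c (m≤n+m c _))))
  ... | free-only 1≤ total≡1  = strict (regroup 1
    (picked 1≤ (≤-trans (s≤s (subst (l + m ≤_) total≡1 l+m≤total)) 2≤Δ)))
  ... | free-full 1≤ _ l≤1 cap≤ = improvable refl l≤1 cap≤ (regroup 0 (picked 1≤ (≤-trans l+m≤total total≤cap)))

-- Picking children, and the density of the picked set.

module Extremal {n} (G : Graph n) (r : Fin n) (R : Rooted G r) (Δ : ℕ) (2≤Δ : 2 ≤ Δ)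
                (deg≤Δ : ∀ v → deg G v ≤ Δ) (deg-r : deg G r ≡ Δ) where
  open Rooted R

  cap : Fin n → ℕ
  cap v = Δ ∸ ⟦ nonroot v ⟧

  open Typing G r R cap public

  nonroot-r : nonroot r ≡ false
  nonroot-r = cong not (≡⇒== {v = r} refl)

  cap-root : cap r ≡ Δ
  cap-root = cong (λ b → Δ ∸ ⟦ b ⟧) nonroot-r

  cap-nonroot : ∀ {v} → v ≢ r → suc (cap v) ≡ Δ
  cap-nonroot v≢r = trans (cong (λ b → suc (Δ ∸ ⟦ b ⟧)) (≢⇒nonroot v≢r)) (m+[n∸m]≡n (≤-trans (n≤1+n 1) 2≤Δ))

  children≤cap : ∀ v → count (child v) ≤ cap v
  children≤cap v = m+n≤o⇒m≤o∸n _ (subst (_≤ Δ) (deg≡children v) (deg≤Δ v))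

  children-root : count (child r) ≡ Δ
  children-root = trans (≡sym (trans (deg≡children r)
    (trans (cong (λ b → count (child r) + ⟦ b ⟧) nonroot-r) (+-identityʳ _)))) deg-r

  total≤cap : ∀ v → # leaf of v + # branch of v + # hub of v + # rich of v + # free of v ≤ cap v
  total≤cap v = subst (_≤ cap v) (#children v) (children≤cap v)

  -- A leaf is preferred to a branch: when the children are branches and a single leaf, the leaf
  -- must be the one picked, since an unpicked leaf would have no child left as a coloured
  -- neighbour.
  data Pick (v : Fin n) : Maybe (Fin n) → Set where
    none   : # leaf of v + # branch of v + # free of v ≡ 0 → Pick v nothing
    free   : ∀ {w} → child v w ≡ true → type w ≡ free → Pick v (just w)
    leaf   : ∀ {w} → child v w ≡ true → type w ≡ leaf → # free of v ≡ 0 → Pick v (just w)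
    branch : ∀ {w} → child v w ≡ true → type w ≡ branch → # free of v ≡ 0 → # leaf of v ≡ 0 → Pick v (just w)

  choose : ∀ v → ∃ (Pick v)
  choose v with 1 ≤? # free of v
  ... | yes p = let _ , vw , tw = #⇒has p in _ , free vw tw
  ... | no ¬f with 1 ≤? # leaf of v
  ...   | yes p = let _ , vw , tw = #⇒has p in _ , leaf vw tw (n<1⇒n≡0 (≰⇒> ¬f))
  ...   | no ¬l with 1 ≤? # branch of v
  ...     | yes p = let _ , vw , tw = #⇒has p in _ , branch vw tw (n<1⇒n≡0 (≰⇒> ¬f)) (n<1⇒n≡0 (≰⇒> ¬l))
  ...     | no ¬b = _ , none (cong₂ _+_ (cong₂ _+_ (n<1⇒n≡0 (≰⇒> ¬l)) (n<1⇒n≡0 (≰⇒> ¬b))) (n<1⇒n≡0 (≰⇒> ¬f)))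

  pick : Fin n → Maybe (Fin n)
  pick v = proj₁ (choose v)

  picked : Fin n → Fin n → Bool
  picked v w = maybe′ (_== w) false (pick v)

  picked⇒pick : ∀ {v w} → picked v w ≡ true → pick v ≡ just w
  picked⇒pick {v} p with pick v
  ... | just x = cong just (==⇒≡ p)

  picked-spec : ∀ {v w} → picked v w ≡ true → Pick v (just w)
  picked-spec {v} p = subst (Pick v) (picked⇒pick p) (proj₂ (choose v))

  picked-unique : ∀ {v w w′} → picked v w ≡ true → picked v w′ ≡ true → w ≡ w′
  picked-unique p q = just-injective (trans (≡sym (picked⇒pick p)) (picked⇒pick q))

  picked-child : ∀ {v w} → picked v w ≡ true → child v w ≡ true
  picked-child p with picked-spec p
  ... | free vw _       = vw
  ... | leaf vw _ _     = vw
  ... | branch vw _ _ _ = vw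

  some-picked : ∀ {v} → 1 ≤ # leaf of v + # branch of v + # free of v → ∃ λ w → picked v w ≡ true
  some-picked {v} 1≤ with choose v
  ... | nothing , none ≡0 = contradiction (subst (1 ≤_) ≡0 1≤) λ ()
  ... | just w  , _       = w , ≡⇒== refl

  none-picked : ∀ {v w} → # leaf of v + # branch of v + # free of v ≡ 0 → picked v w ≡ false
  none-picked {v} {w} ≡0 = ≢true⇒false λ p → refute (picked-spec p)
    where
    absurd : 1 ≤ # leaf of v + # branch of v + # free of v → ⊥
    absurd 1≤ = contradiction (subst (1 ≤_) ≡0 1≤) λ ()
    refute : ¬ Pick v (just w)
    refute (free vw tw)       = absurd (≤-trans (has⇒# vw tw) (m≤n+m _ _))
    refute (leaf vw tw _)     = absurd (≤-trans (has⇒# vw tw) (≤-trans (m≤m+n _ _) (m≤m+n _ _)))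
    refute (branch vw tw _ _) = absurd (≤-trans (has⇒# vw tw) (≤-trans (m≤n+m _ (# leaf of v)) (m≤m+n _ _)))

  picks : Fin n → ℕ
  picks v = count (picked v)

  picks≡1 : ∀ v → 1 ≤ # leaf of v + # branch of v + # free of v → picks v ≡ 1
  picks≡1 v 1≤ = let w , p = some-picked 1≤ in count-one (picked v) p (λ u q → picked-unique q p)

  -- The root is outside this set whatever `par r` is, because only children are picked.
  U₀ : Fin n → Bool
  U₀ w = picked (par w) w

  count-U₀ : count U₀ ≡ sum picks
  count-U₀ = ≡sym (trans (∑-comm (λ v w → ⟦ picked v w ⟧)) (sum-cong-≗ λ w →
    sum-single (λ v → ⟦ picked v w ⟧) (par w) λ v v≢ → cong ⟦_⟧ (≢true⇒false λ p →
      v≢ (≡sym (child⇒par (picked-child p))))))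

  child-surplus : Fin n → ℕ
  child-surplus v = sum (λ w → ⟦ child v w ⟧ * surplus (type w))

  -- On summing the local inequalities, the surplus of each nonroot vertex appears on the left for
  -- itself and on the right as that of a child, and cancels. What is left compares the `n` minus 1
  -- nonroot vertices with `Δ` times the picks. At the root the margin `e` stands in for the
  -- surplus.
  density : ∀ e → e + count (child r) ≤ Δ * picks r + child-surplus r → n + e ≤ Δ * count U₀ + 1
  density e at-root = +-cancelˡ-≤ total _ _ (begin
    total + (n + e)                               ≡⟨ cong (λ x → total + (x + e)) (≡sym count-nonroot) ⟩
    total + (count nonroot + 1 + e)               ≡⟨ shuffle₁ total (count nonroot) e ⟩
    total + e + count nonroot + 1                 ≡⟨ cong (_+ 1) (≡sym lhs-sum) ⟩
    sum (λ v → own v + root v + count (child v)) + 1 ≤⟨ +-monoˡ-≤ 1 (sum-mono local) ⟩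
    sum (λ v → Δ * picks v + child-surplus v) + 1 ≡⟨ cong (_+ 1) (∑-distrib-+ (λ v → Δ * picks v) child-surplus) ⟩
    sum (λ v → Δ * picks v) + sum child-surplus + 1
      ≡⟨ cong₂ (λ x y → x + y + 1) (≡sym (*-distribˡ-sum Δ picks)) (∑-children (surplus ∘ type)) ⟩
    Δ * sum picks + total + 1                     ≡⟨ cong (λ x → Δ * x + total + 1) (≡sym count-U₀) ⟩
    Δ * count U₀ + total + 1                      ≡⟨ shuffle₂ (Δ * count U₀) total ⟩
    total + (Δ * count U₀ + 1)                    ∎)
    where
    open ≤-Reasoning
    own root : Fin n → ℕ
    own v  = ⟦ nonroot v ⟧ * surplus (type v)
    root v = ⟦ v == r ⟧ * e
    total : ℕ
    total = sum own
    shuffle₁ : ∀ x y e → x + (y + 1 + e) ≡ x + e + y + 1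
    shuffle₁ = solve-∀
    shuffle₂ : ∀ x y → x + y + 1 ≡ y + (x + 1)
    shuffle₂ = solve-∀
    sum-root : sum root ≡ e
    sum-root = trans (sum-single root r (λ v v≢r → cong (λ b → ⟦ b ⟧ * e) (≢⇒== v≢r)))
      (trans (cong (λ b → ⟦ b ⟧ * e) (≡⇒== {v = r} refl)) (*-identityˡ e))
    sum-children : sum (λ v → count (child v)) ≡ count nonroot
    sum-children = trans (∑-comm (λ v w → ⟦ child v w ⟧)) (sum-cong-≗ parents)
    lhs-sum : sum (λ v → own v + root v + count (child v)) ≡ total + e + count nonroot
    lhs-sum = trans (∑-distrib-+ (λ v → own v + root v) _)
      (cong₂ _+_ (trans (∑-distrib-+ own root) (cong (total +_) sum-root)) sum-children)
    local : ∀ v → own v + root v + count (child v) ≤ Δ * picks v + child-surplus v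
    local v with v Fin.≟ r
    ... | yes refl = subst (λ x → x + count (child r) ≤ Δ * picks r + child-surplus r)
      (cong₂ (λ b b′ → ⟦ b ⟧ * surplus (type r) + ⟦ b′ ⟧ * e) (≡sym nonroot-r) (≡sym (≡⇒== {v = r} refl)))
      (subst (λ x → x + count (child r) ≤ Δ * picks r + child-surplus r) (≡sym (*-identityˡ e)) at-root)
    ... | no v≢r = subst₂ (λ b b′ → ⟦ b ⟧ * surplus (type v) + ⟦ b′ ⟧ * e + count (child v) ≤ Δ * picks v + child-surplus v)
      (≡sym (≢⇒nonroot v≢r)) (≡sym (≢⇒== v≢r))
      (subst₂ _≤_
        (cong₂ _+_ (trans (≡sym (*-identityˡ _)) (≡sym (+-identityʳ _))) (≡sym (#children v)))
        (cong (Δ * picks v +_) (≡sym (#surplus v)))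
        (gain 2≤Δ (total≤cap v) (picks≡1 v) (type-spec v) (cap-nonroot v≢r)))

-- Total forcing sets as complements of picked sets.

module _ {n} {G : Graph n} {r : Fin n} (R : Rooted G r) where
  open Rooted R

  -- Induction on the rank: when a vertex of `U` is due, its parent and grandparent are already
  -- coloured and its siblings lie outside `U`, so the parent forces it.
  top-down : (U : Fin n → Bool) →
    (∀ {v w w′} → child v w ≡ true → child v w′ ≡ true → U w ≡ true → U w′ ≡ true → w ≡ w′) →
    Colored G (tabulate (not ∘ U)) r → IsForcingSet G (tabulate (not ∘ U))
  top-down U siblings root v = go (suc (rank v)) v ≤-refl
    where
    go : ∀ k v → rank v < k → Colored G (tabulate (not ∘ U)) v
    go (suc k) v v<k with v Fin.≟ r | U v in Uv
    ... | yes refl | _     = root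
    ... | no _     | false = init (∈-tabulate⁺ (cong not Uv))
    ... | no v≢r   | true  = force (below (par v) (par-rank v v≢r)) (par-adj v v≢r) others
      where
      below : ∀ w → rank w < rank v → Colored G (tabulate (not ∘ U)) w
      below w w<v = go k w (≤-trans w<v (≤-pred v<k))
      others : ∀ w → Adj G (par v) w → w ≢ v → Colored G (tabulate (not ∘ U)) w
      others w uw w≢v with adj⇒child uw
      ... | inj₂ wu = below w (<-trans (child-rank wu) (par-rank v v≢r))
      ... | inj₁ uw′ = init (∈-tabulate⁺ (cong not (≢true⇒false λ Uw →
        w≢v (siblings uw′ (par-child v≢r) Uw Uv))))

module Construction {n} (G : Graph n) (r : Fin n) (R : Rooted G r) (Δ : ℕ) (2≤Δ : 2 ≤ Δ)
                    (deg≤Δ : ∀ v → deg G v ≤ Δ) (deg-r : deg G r ≡ Δ) where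
  open Rooted R
  open Extremal G r R Δ 2≤Δ deg≤Δ deg-r

  Full : Fin n → Set
  Full v = # leaf of v ≤ 1 × cap v ≤ # leaf of v + # branch of v

  full-children : ∀ {v w} → cap v ≤ # leaf of v + # branch of v → child v w ≡ true → type w ≡ leaf ⊎ type w ≡ branch
  full-children {v} {w} cap≤ vw
    with full⇒others-none (# leaf of v) (# branch of v) (# hub of v) (# rich of v) (# free of v) (total≤cap v) cap≤ | type w in tw
  ... | _                | leaf   = inj₁ refl
  ... | _                | branch = inj₂ refl
  ... | a≡0 , _          | hub    = contradiction (subst (1 ≤_) a≡0 (has⇒# vw tw)) λ ()
  ... | _   , c≡0 , _    | rich   = contradiction (subst (1 ≤_) c≡0 (has⇒# vw tw)) λ ()
  ... | _   , _   , d≡0  | free   = contradiction (subst (1 ≤_) d≡0 (has⇒# vw tw)) λ ()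

  one-leaf : ∀ {v w w′} → # leaf of v ≤ 1 → child v w ≡ true → child v w′ ≡ true →
    type w ≡ leaf → type w′ ≡ leaf → w ≡ w′
  one-leaf {v} {w} {w′} l≤1 vw vw′ tw tw′ with w Fin.≟ w′
  ... | yes eq = eq
  ... | no neq = contradiction l≤1 (<⇒≱ (∃₂⇒count (λ u → child v u ∧ is (type u) leaf) neq
    (cong₂ _∧_ vw (≡⇒is tw)) (cong₂ _∧_ vw′ (≡⇒is tw′))))

  -- With at most one leaf child available, the leaf is the one picked.
  full-unpicked : ∀ {v w} → Full v → child v w ≡ true → picked v w ≡ false → type w ≡ branch
  full-unpicked {v} {w} full vw unpicked with full-children (proj₂ full) vw
  ... | inj₂ tw = tw
  ... | inj₁ tw with some-picked {v} (≤-trans (has⇒# vw tw) (≤-trans (m≤m+n _ _) (m≤m+n _ _)))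
  ...   | x , p with picked-spec p
  ...     | leaf vx tx _       = ⊥-elim (true≢false p
    (subst (λ y → picked v y ≡ false) (one-leaf (proj₁ full) vw vx tw tx) unpicked))
  ...     | branch _ _ _ l≡0   = contradiction (subst (1 ≤_) l≡0 (has⇒# vw tw)) λ ()
  ...     | free vx tx with full-children (proj₂ full) vx
  ...       | inj₁ tx′ = case trans (≡sym tx) tx′ of λ ()
  ...       | inj₂ tx′ = case trans (≡sym tx) tx′ of λ ()

  unpicked-child : ∀ v → 2 ≤ count (child v) → ∃ λ w → child v w ≡ true × picked v w ≡ false
  unpicked-child v 2≤ with count⇒∃₂ (child v) 2≤
  ... | w , w′ , w≢w′ , vw , vw′ with picked v w in p | picked v w′ in p′
  ...   | false | _     = w , vw , p
  ...   | true  | false = w′ , vw′ , p′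
  ...   | true  | true  = ⊥-elim (w≢w′ (picked-unique p p′))

  -- These types keep a coloured neighbour below them even if the parent is uncoloured: a branch has
  -- a hub child and picks nothing, while a hub or rich vertex has two children and picks at most
  -- one.
  sustaining : ∀ v → type v ≡ branch ⊎ type v ≡ hub ⊎ type v ≡ rich →
    ∃ λ w → child v w ≡ true × picked v w ≡ false
  sustaining v (inj₁ tv) with subst (TypeSpec type v) tv (type-spec v)
  ... | branch ≡0 _ 1≤a = let w , vw , _ = #⇒has {v} {hub} 1≤a in w , vw , none-picked ≡0
  sustaining v (inj₂ (inj₁ tv)) with subst (TypeSpec type v) tv (type-spec v)
  ... | hub 2≤l _ = unpicked-child v (subst (2 ≤_) (≡sym (#children v))
    (≤-trans 2≤l (≤-trans (m≤m+n _ _) (≤-trans (m≤m+n _ _) (≤-trans (m≤m+n _ _) (m≤m+n _ _))))))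
  sustaining v (inj₂ (inj₂ tv)) with subst (TypeSpec type v) tv (type-spec v)
  ... | rich _ 2≤ _ = unpicked-child v (subst (2 ≤_) (≡sym (#children v)) 2≤)

  -- When ρ holds, the root is uncoloured too; an unpicked branch child then forces it.
  module _ (ρ : Bool) (root-full : ρ ≡ true → type r ≡ free × Full r) where

    U : Fin n → Bool
    U w = U₀ w ∨ (ρ ∧ (w == r))

    U-child : ∀ {v w} → child v w ≡ true → U w ≡ picked v w
    U-child {v} {w} vw = trans (cong₂ (λ u b → picked u w ∨ (ρ ∧ b)) (child⇒par vw) (≢⇒== (child⇒≢r vw)))
      (trans (cong (picked v w ∨_) (Bool.∧-zeroʳ ρ)) (Bool.∨-identityʳ _))

    uncoloured-type : ∀ {v} → U v ≡ true → type v ≡ leaf ⊎ type v ≡ branch ⊎ type v ≡ free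
    uncoloured-type {v} p with ∨-true {U₀ v} p
    ... | inj₁ q with picked-spec q
    ...   | free _ t       = inj₂ (inj₂ t)
    ...   | leaf _ t _     = inj₁ t
    ...   | branch _ t _ _ = inj₂ (inj₁ t)
    uncoloured-type {v} p | inj₂ q with ∧-true {ρ} q
    ... | ρt , v≡r = inj₂ (inj₂ (subst (λ u → type u ≡ free) (≡sym (==⇒≡ v≡r)) (proj₁ (root-full ρt))))

    -- By the type of `u`: a leaf has no children; a branch or `free-none` vertex has no leaf or
    -- free child; in `free-only` the sole child is picked; in `free-full` the unpicked children are
    -- branches.
    sustained : ∀ {u v} → U u ≡ true → child u v ≡ true → picked u v ≡ false →
      type v ≡ branch ⊎ type v ≡ hub ⊎ type v ≡ rich
    sustained {u} {v} Uu uv unpicked with uncoloured-type Uu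
    sustained {u} {v} Uu uv unpicked | inj₁ tu with subst (TypeSpec type u) tu (type-spec u)
    ... | leaf ≡0 = contradiction (subst (1 ≤_) (trans (#children u) ≡0) (count-≥1 (child u) uv)) λ ()
    sustained {u} {v} Uu uv unpicked | inj₂ (inj₁ tu) with subst (TypeSpec type u) tu (type-spec u) | type v in tv
    ... | branch _ _ _    | branch = inj₁ refl
    ... | branch _ _ _    | hub    = inj₂ (inj₁ refl)
    ... | branch _ _ _    | rich   = inj₂ (inj₂ refl)
    ... | branch ≡0 _ _   | leaf   = contradiction (subst (1 ≤_) ≡0
      (≤-trans (has⇒# uv tv) (≤-trans (m≤m+n _ _) (m≤m+n _ _)))) λ ()
    ... | branch ≡0 _ _   | free   = contradiction (subst (1 ≤_) ≡0 (≤-trans (has⇒# uv tv) (m≤n+m _ _))) λ ()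
    sustained {u} {v} Uu uv unpicked | inj₂ (inj₂ tu) with subst (TypeSpec type u) tu (type-spec u)
    ... | free-full _ _ l≤1 cap≤ = inj₁ (full-unpicked (l≤1 , cap≤) uv unpicked)
    ... | free-only 1≤ total≡1 with some-picked {u} 1≤
    ...   | w , p with v Fin.≟ w
    ...     | yes refl = ⊥-elim (true≢false p unpicked)
    ...     | no v≢w   = contradiction (≤-reflexive (trans (#children u) total≡1))
      (<⇒≱ (∃₂⇒count (child u) v≢w uv (picked-child p)))
    sustained {u} {v} Uu uv unpicked | inj₂ (inj₂ tu) | free-none ≡0 _ with type v in tv
    ... | branch = inj₁ refl
    ... | hub    = inj₂ (inj₁ refl)
    ... | rich   = inj₂ (inj₂ refl)
    ... | leaf   = contradiction (subst (1 ≤_) ≡0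
      (≤-trans (has⇒# uv tv) (≤-trans (m≤m+n _ _) (m≤m+n _ _)))) λ ()
    ... | free   = contradiction (subst (1 ≤_) ≡0 (≤-trans (has⇒# uv tv) (m≤n+m _ _))) λ ()

    coloured-neighbour : ∀ v → U v ≡ false → ∃ λ u → U u ≡ false × Adj G v u
    coloured-neighbour v Uv with v Fin.≟ r
    ... | yes refl = let w , rw , p = unpicked-child r (subst (2 ≤_) (≡sym children-root) 2≤Δ)
                     in w , trans (U-child rw) p , child-adj rw
    ... | no v≢r with U (par v) in Uu
    ...   | false = par v , Uu , trans (sym G v (par v)) (par-adj v v≢r)
    ...   | true  =
      let pv = par-child v≢r
          w , vw , p = sustaining v (sustained Uu pv (trans (≡sym (U-child pv)) Uv))
      in w , trans (U-child vw) p , child-adj vw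

    S : Subset n
    S = tabulate (not ∘ U)

    root-coloured : Colored G S r
    root-coloured with U r in Ur
    ... | false = init (∈-tabulate⁺ (cong not Ur))
    ... | true with ∨-true {U₀ r} Ur
    ...   | inj₁ p = ⊥-elim (child⇒≢r (picked-child p) refl)
    ...   | inj₂ p with root-full (proj₁ (∧-true {ρ} p)) | unpicked-child r (subst (2 ≤_) (≡sym children-root) 2≤Δ)
    ...     | tr , full | b , rb , unpicked with full-unpicked full rb unpicked
    ...       | tb with subst (TypeSpec type b) tb (type-spec b)
    -- A branch picks none of its children, so `r` is the only neighbour of `b` outside `S`.
    ...         | branch ≡0 _ _ = force {u = b} (init (∈-tabulate⁺ (cong not (trans (U-child rb) unpicked))))
      (trans (sym G b r) (child-adj rb))
      λ w bw w≢r → case adj⇒child bw of λ where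
        (inj₁ bw′) → init (∈-tabulate⁺ (cong not (trans (U-child bw′) (none-picked ≡0))))
        (inj₂ wb)  → ⊥-elim (w≢r (trans (≡sym (child⇒par wb)) (child⇒par rb)))

    valid : IsTFSet G S
    valid = top-down R U
        (λ vw vw′ p p′ → picked-unique (trans (≡sym (U-child vw)) p) (trans (≡sym (U-child vw′)) p′))
        root-coloured
      , λ v v∈S → let u , Uu , vu = coloured-neighbour v (not-true (∈-tabulate⁻ v∈S))
                  in u , ∈-tabulate⁺ (cong not Uu) , vu
      where
      not-true : ∀ {b} → not b ≡ true → b ≡ false
      not-true {false} _ = refl

    ∣S∣+U : ∣ S ∣ + count U ≡ n
    ∣S∣+U = trans (cong (_+ count U) (∣tabulate∣ (not ∘ U))) (count-not U)

    count-U : count U ≡ count U₀ + ⟦ ρ ⟧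
    count-U = trans (sum-cong-≗ split) (trans (∑-distrib-+ (⟦_⟧ ∘ U₀) (λ v → ⟦ ρ ∧ (v == r) ⟧))
      (cong (count U₀ +_) root-sum))
      where
      split : ∀ v → ⟦ U v ⟧ ≡ ⟦ U₀ v ⟧ + ⟦ ρ ∧ (v == r) ⟧
      split v with U₀ v in p | ρ ∧ (v == r) in q
      ... | false | _     = refl
      ... | true  | false = refl
      ... | true  | true  = ⊥-elim (child⇒≢r (picked-child p) (==⇒≡ (proj₂ (∧-true {ρ} q))))
      root-sum : sum (λ v → ⟦ ρ ∧ (v == r) ⟧) ≡ ⟦ ρ ⟧
      root-sum = trans (sum-single (λ v → ⟦ ρ ∧ (v == r) ⟧) r
          (λ v v≢r → cong ⟦_⟧ (trans (cong (ρ ∧_) (≢⇒== v≢r)) (Bool.∧-zeroʳ ρ))))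
        (cong ⟦_⟧ (trans (cong (ρ ∧_) (≡⇒== {v = r} refl)) (Bool.∧-identityʳ ρ)))

  -- The margin `e` is 0 for the bound itself and 1 for its strict form.
  Bound : ℕ → Set
  Bound e = ∃ λ S → IsTFSet G S × (Δ * ∣ S ∣ + e ≤ (Δ ∸ 1) * n + 1)

  -- Since `S` and `U` are complementary, a lower bound on the size of `U` is an upper bound on that
  -- of `S`; `n` is added to both sides to avoid subtraction.
  bound : ∀ ρ root-full e → n + e ≤ Δ * (count U₀ + ⟦ ρ ⟧) + 1 → Bound e
  bound ρ root-full e le = S ρ root-full , valid ρ root-full , +-cancelʳ-≤ n _ _ (begin
    Δ * s + e + n                 ≡⟨ shuffle₁ (Δ * s) e n ⟩
    Δ * s + (n + e)               ≤⟨ +-monoʳ-≤ (Δ * s) le ⟩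
    Δ * s + (Δ * (count U₀ + ⟦ ρ ⟧) + 1) ≡⟨ cong (λ x → Δ * s + (Δ * x + 1)) (≡sym (count-U ρ root-full)) ⟩
    Δ * s + (Δ * u + 1)           ≡⟨ shuffle₂ Δ s u ⟩
    Δ * (s + u) + 1               ≡⟨ cong (λ x → Δ * x + 1) (∣S∣+U ρ root-full) ⟩
    Δ * n + 1                     ≡⟨ cong (λ x → x * n + 1) (m+[n∸m]≡n (≤-trans (n≤1+n 1) 2≤Δ)) ⟨
    (n + (Δ ∸ 1) * n) + 1         ≡⟨ shuffle₃ n ((Δ ∸ 1) * n) ⟩
    (Δ ∸ 1) * n + 1 + n           ∎)
    where
    open ≤-Reasoning
    s u : ℕ
    s = ∣ S ρ root-full ∣
    u = count (U ρ root-full)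
    shuffle₁ : ∀ x e n → x + e + n ≡ x + (n + e)
    shuffle₁ = solve-∀
    shuffle₂ : ∀ d s u → d * s + (d * u + 1) ≡ d * (s + u) + 1
    shuffle₂ = solve-∀
    shuffle₃ : ∀ n x → n + x + 1 ≡ x + 1 + n
    shuffle₃ = solve-∀

  at-root : ∀ e → e + (# leaf of r + # branch of r + # hub of r + # rich of r + # free of r)
    ≤ Δ * picks r + (# hub of r + 2 * # rich of r + # free of r) → n + e ≤ Δ * count U₀ + 1
  at-root e le = density e (subst₂ _≤_ (cong (e +_) (≡sym (#children r)))
    (cong (Δ * picks r +_) (≡sym (#surplus r))) le)

  tight-or-improvable : ((type r ≡ branch ⊎ type r ≡ hub) × Bound 0) ⊎ Bound 1
  tight-or-improvable with root-kind 2≤Δ (total≤cap r) {picks r} (picks≡1 r) (type-spec r) cap-root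
    (subst (1 ≤_) (trans (≡sym children-root) (#children r)) (≤-trans (n≤1+n 1) 2≤Δ))
  ... | tight t le = inj₁ (t , bound false (λ ()) 0
    (subst (λ x → n + 0 ≤ Δ * x + 1) (≡sym (+-identityʳ _)) (at-root 0 le)))
  ... | strict le = inj₂ (bound false (λ ()) 1
    (subst (λ x → n + 1 ≤ Δ * x + 1) (≡sym (+-identityʳ _)) (at-root 1 le)))
  -- Putting the root into `U` adds `Δ` on the right, which more than covers the missing 1.
  ... | improvable tr l≤1 cap≤ le = inj₂ (bound true (λ _ → tr , l≤1 , cap≤) 1 (begin
    n + 1                        ≡⟨ cong (_+ 1) (+-identityʳ n) ⟨
    n + 0 + 1                    ≤⟨ +-mono-≤ (at-root 0 le) (≤-trans (n≤1+n 1) 2≤Δ) ⟩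
    Δ * count U₀ + 1 + Δ         ≡⟨ shuffle Δ (count U₀) ⟩
    Δ * (count U₀ + 1) + 1       ∎))
    where
    open ≤-Reasoning
    shuffle : ∀ d u → d * u + 1 + d ≡ d * (u + 1) + 1
    shuffle = solve-∀

-- The tight case: decomposition into stars centred at hubs.

module Family {n} (G : Graph n) (r : Fin n) (R : Rooted G r) (Δ : ℕ) (2≤Δ : 2 ≤ Δ)
              (deg≤Δ : ∀ v → deg G v ≤ Δ) (deg-r : deg G r ≡ Δ) where
  open Rooted R
  open Extremal G r R Δ 2≤Δ deg≤Δ deg-r
  open Construction G r R Δ 2≤Δ deg≤Δ deg-r using (full-children)

  hub-children : ∀ {v w} → type v ≡ hub → child v w ≡ true → type w ≡ leaf ⊎ type w ≡ branch
  hub-children {v} tv vw with subst (TypeSpec type v) tv (type-spec v)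
  ... | hub _ cap≤ = full-children cap≤ vw

  branch-children : ∀ {v w} → type v ≡ branch → child v w ≡ true → type w ≡ hub
  branch-children {v} {w} tv vw with subst (TypeSpec type v) tv (type-spec v) | type w in tw
  ... | branch _ _ _   | hub    = refl
  ... | branch _ c≡0 _ | rich   = contradiction (subst (1 ≤_) c≡0 (has⇒# vw tw)) λ ()
  ... | branch ≡0 _ _  | leaf   = contradiction (subst (1 ≤_) ≡0
    (≤-trans (has⇒# vw tw) (≤-trans (m≤m+n _ _) (m≤m+n _ _)))) λ ()
  ... | branch ≡0 _ _  | branch = contradiction (subst (1 ≤_) ≡0
    (≤-trans (has⇒# vw tw) (≤-trans (m≤n+m _ (# leaf of v)) (m≤m+n _ _)))) λ ()
  ... | branch ≡0 _ _  | free   = contradiction (subst (1 ≤_) ≡0 (≤-trans (has⇒# vw tw) (m≤n+m _ _))) λ ()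

  leaf-childless : ∀ {v} → type v ≡ leaf → count (child v) ≡ 0
  leaf-childless {v} tv with subst (TypeSpec type v) tv (type-spec v)
  ... | leaf ≡0 = trans (#children v) ≡0

  no-leaf-child : ∀ {v w} → type v ≡ leaf → child v w ≡ true → ⊥
  no-leaf-child {v} tv vw = contradiction (subst (1 ≤_) (leaf-childless tv) (count-≥1 (child v) vw)) λ ()

  -- The leaf and branch children alone already fill the capacity.
  hub-count : ∀ {v} → type v ≡ hub → count (child v) ≡ cap v
  hub-count {v} tv with subst (TypeSpec type v) tv (type-spec v)
  ... | hub _ cap≤ = ≤-antisym (children≤cap v) (≤-trans cap≤ (subst (# leaf of v + # branch of v ≤_)
    (≡sym (#children v)) (≤-trans (m≤m+n _ _) (≤-trans (m≤m+n _ _) (m≤m+n _ _)))))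

  deg-hub : ∀ {v} → type v ≡ hub → deg G v ≡ Δ
  deg-hub {v} tv with v Fin.≟ r
  ... | yes refl = deg-r
  ... | no v≢r   = begin
    deg G v                          ≡⟨ deg≡children v ⟩
    count (child v) + ⟦ nonroot v ⟧  ≡⟨ cong₂ _+_ (hub-count tv) (cong ⟦_⟧ (≢⇒nonroot v≢r)) ⟩
    cap v + 1                        ≡⟨ +-comm (cap v) 1 ⟩
    suc (cap v)                      ≡⟨ cap-nonroot v≢r ⟩
    Δ                                ∎
    where open ≡-Reasoning

  deg-leaf-child : ∀ {v w} → child v w ≡ true → type w ≡ leaf → deg G w ≡ 1
  deg-leaf-child vw tw =
    trans (deg≡children _) (cong₂ _+_ (leaf-childless tw) (cong ⟦_⟧ (≢⇒nonroot (child⇒≢r vw))))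

  hub-strong : ∀ {v} → type v ≡ hub → StrongSupport G v
  hub-strong {v} tv with subst (TypeSpec type v) tv (type-spec v)
  ... | hub 2≤l _ with count⇒∃₂ (λ w → child v w ∧ is (type w) leaf) 2≤l
  ...   | a , b , a≢b , p , q =
    let va , ta = ∧-true {child v a} p
        vb , tb = ∧-true {child v b} q
    in a , b , a≢b , child-adj va , child-adj vb , deg-leaf-child va (is⇒≡ ta) , deg-leaf-child vb (is⇒≡ tb)

  hubs-independent : ∀ {u v} → type u ≡ hub → type v ≡ hub → adj G u v ≡ false
  hubs-independent tu tv = ≢true⇒false λ uv → case adj⇒child uv of λ where
      (inj₁ c) → refute tv (hub-children tu c)
      (inj₂ c) → refute tu (hub-children tv c)
    where
    refute : ∀ {t} → t ≡ hub → t ≡ leaf ⊎ t ≡ branch → ⊥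
    refute refl (inj₁ ())
    refute refl (inj₂ ())

  -- The first star is K_{1,Δ}: it contains the root, as its centre or as one of its leaves.
  first-hub : type r ≡ branch ⊎ type r ≡ hub →
    ∃ λ x → type x ≡ hub × (x ≡ r ⊎ type r ≢ hub × child r x ≡ true)
  first-hub (inj₂ t) = r , t , inj₁ refl
  first-hub (inj₁ t) with subst (TypeSpec type r) t (type-spec r)
  ... | branch _ _ 1≤a = let x , rx , tx = #⇒has {r} {hub} 1≤a
                         in x , tx , inj₂ ((λ t′ → case trans (≡sym t) t′ of λ ()) , rx)

  module _ (tight : type r ≡ branch ⊎ type r ≡ hub) where

    -- From a tight root downwards the layers alternate: below a branch are only hubs, below a hub
    -- only leaves and branches. So rich and free vertices never occur.
    regular : ∀ v → type v ≡ leaf ⊎ type v ≡ branch ⊎ type v ≡ hub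
    regular v = go (suc (rank v)) v ≤-refl
      where
      go : ∀ k v → rank v < k → type v ≡ leaf ⊎ type v ≡ branch ⊎ type v ≡ hub
      go (suc k) v v<k with v Fin.≟ r
      ... | yes refl = inj₂ tight
      ... | no v≢r with go k (par v) (≤-trans (par-rank v v≢r) (≤-pred v<k))
      ...   | inj₁ t        = ⊥-elim (no-leaf-child t (par-child v≢r))
      ...   | inj₂ (inj₁ t) = inj₂ (inj₂ (branch-children t (par-child v≢r)))
      ...   | inj₂ (inj₂ t) = case hub-children t (par-child v≢r) of λ where
        (inj₁ t′) → inj₁ t′
        (inj₂ t′) → inj₂ (inj₁ t′)

    parent-type : ∀ {v w} → child v w ≡ true → type w ≢ hub → type v ≡ hub
    parent-type {v} vw tw with regular v
    ... | inj₁ t        = ⊥-elim (no-leaf-child t vw)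
    ... | inj₂ (inj₁ t) = ⊥-elim (tw (branch-children t vw))
    ... | inj₂ (inj₂ t) = t

    nonhubs-independent : ∀ {u v} → type u ≢ hub → type v ≢ hub → adj G u v ≡ false
    nonhubs-independent tu tv = ≢true⇒false λ uv → case adj⇒child uv of λ where
      (inj₁ c) → tu (parent-type c tv)
      (inj₂ c) → tv (parent-type c tu)

    hub-neighbour : ∀ {u v} → type u ≡ hub → Adj G u v → type v ≢ hub
    hub-neighbour tu uv tv = true≢false uv (hubs-independent tu tv)

    first = first-hub tight

    x₁ : Fin n
    x₁ = proj₁ first

    -- A hub owns itself and its children. A root that is not a hub has no parent to own it and goes
    -- to its child `x₁`, whose star is thereby one ray larger than the others.
    owner : ∀ v → ∃ λ c → type c ≡ hub
      × (type v ≡ hub → c ≡ v)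
      × (type v ≢ hub → (v ≡ r × c ≡ x₁) ⊎ child c v ≡ true)
    owner v with type v ≟ᵗ hub | v Fin.≟ r
    ... | yes t | _      = v , t , (λ _ → refl) , λ ¬t → contradiction t ¬t
    ... | no ¬t | yes eq = x₁ , proj₁ (proj₂ first) , (λ t → contradiction t ¬t) , λ _ → inj₁ (eq , refl)
    ... | no ¬t | no v≢r = par v , parent-type (par-child v≢r) ¬t , (λ t → contradiction t ¬t) , λ _ → inj₂ (par-child v≢r)

    own : Fin n → Fin n
    own v = proj₁ (owner v)

    own-hub : ∀ v → type (own v) ≡ hub
    own-hub v = proj₁ (proj₂ (owner v))

    own-self : ∀ {v} → type v ≡ hub → own v ≡ v
    own-self {v} = proj₁ (proj₂ (proj₂ (owner v)))

    own-nonhub : ∀ {v} → type v ≢ hub → (v ≡ r × own v ≡ x₁) ⊎ child (own v) v ≡ true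
    own-nonhub {v} = proj₂ (proj₂ (proj₂ (owner v)))

    owned : Fin n → Fin n → Bool
    owned c w = (own w == c) ∧ not (w == c)

    mk-owned : ∀ {c w} → own w ≡ c → w ≢ c → owned c w ≡ true
    mk-owned p q = cong₂ _∧_ (≡⇒== p) (cong not (≢⇒== q))

    owned⇒own : ∀ {c w} → owned c w ≡ true → own w ≡ c
    owned⇒own p = ==⇒≡ (proj₁ (∧-true p))

    owned⇒≢ : ∀ {c w} → owned c w ≡ true → w ≢ c
    owned⇒≢ {c} {w} p w≡c = true≢false (proj₂ (∧-true {own w == c} p)) (cong not (≡⇒== w≡c))

    owned⇒nonhub : ∀ {c w} → owned c w ≡ true → type w ≢ hub
    owned⇒nonhub p t = owned⇒≢ p (trans (≡sym (own-self t)) (owned⇒own p))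

    root-adj-x₁ : type r ≢ hub → Adj G x₁ r
    root-adj-x₁ ¬t with proj₂ (proj₂ first)
    ... | inj₁ x≡r      = contradiction (subst (λ x → type x ≡ hub) x≡r (proj₁ (proj₂ first))) ¬t
    ... | inj₂ (_ , rx) = trans (sym G x₁ r) (child-adj rx)

    owned⇒adj : ∀ {c w} → owned c w ≡ true → Adj G c w
    owned⇒adj {c} {w} p with own-nonhub (owned⇒nonhub p)
    ... | inj₁ (w≡r , o) = subst₂ (Adj G) (trans (≡sym o) (owned⇒own p)) (≡sym w≡r)
      (root-adj-x₁ (λ t → owned⇒nonhub p (trans (cong type w≡r) t)))
    ... | inj₂ cw        = subst (λ c → Adj G c w) (owned⇒own p) (child-adj cw)

    child⇒own : ∀ {c w} → type w ≢ hub → child c w ≡ true → own w ≡ c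
    child⇒own ¬t cw with own-nonhub ¬t
    ... | inj₁ (w≡r , _) = contradiction w≡r (child⇒≢r cw)
    ... | inj₂ cw′       = trans (≡sym (child⇒par cw′)) (child⇒par cw)

    hub≢ : ∀ {c w} → type c ≡ hub → type w ≢ hub → w ≢ c
    hub≢ tc tw refl = tw tc

    owned-x₁ : ∀ w → owned x₁ w ≡ adj G x₁ w
    owned-x₁ w = bool-ext owned⇒adj from
      where
      tx : type x₁ ≡ hub
      tx = proj₁ (proj₂ first)
      from : Adj G x₁ w → owned x₁ w ≡ true
      from xw with hub-neighbour tx xw
      ... | ¬t with own-nonhub ¬t
      ...   | inj₁ (_ , o) = mk-owned o (hub≢ tx ¬t)
      ...   | inj₂ ow with adj⇒child xw
      ...     | inj₁ c = mk-owned (child⇒own ¬t c) (hub≢ tx ¬t)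
      ...     | inj₂ c with proj₂ (proj₂ first)
      ...       | inj₁ x≡r       = contradiction x≡r (child⇒≢r c)
      -- Here `w` is the parent of `x₁` and hence the root, which is nobody's child.
      ...       | inj₂ (_ , rx)  = contradiction (trans (≡sym (child⇒par c)) (child⇒par rx)) (child⇒≢r ow)

    -- The only nonhub owned by someone other than its parent is the root, and its owner is `x₁`.
    owned-other : ∀ {c} → type c ≡ hub → c ≢ x₁ → ∀ w → owned c w ≡ child c w
    owned-other {c} tc c≢x₁ w = bool-ext to from
      where
      to : owned c w ≡ true → child c w ≡ true
      to p with own-nonhub (owned⇒nonhub p)
      ... | inj₁ (_ , o) = contradiction (trans (≡sym (owned⇒own p)) o) c≢x₁
      ... | inj₂ cw      = subst (λ c → child c w ≡ true) (owned⇒own p) cw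
      from : child c w ≡ true → owned c w ≡ true
      from cw = mk-owned (child⇒own ¬t cw) (hub≢ tc ¬t)
        where ¬t = hub-neighbour tc (child-adj cw)

    others : Fin n → Bool
    others v = is (type v) hub ∧ not (v == x₁)

    k′ : ℕ
    k′ = count others

    centre : Fin (suc k′) → Fin n
    centre zero    = x₁
    centre (suc i) = proj₁ (enumerate others) i

    centre-other : ∀ i → type (centre (suc i)) ≡ hub × centre (suc i) ≢ x₁
    centre-other i = let p , q = ∧-true {is (type (centre (suc i))) hub} (proj₁ (proj₂ (proj₂ (enumerate others))) i)
      in is⇒≡ p , λ eq → true≢false q (cong not (≡⇒== eq))

    centre-hub : ∀ i → type (centre i) ≡ hub
    centre-hub zero    = proj₁ (proj₂ first)
    centre-hub (suc i) = proj₁ (centre-other i)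

    centre-injective : Injective _≡_ _≡_ centre
    centre-injective {zero}  {zero}  _ = refl
    centre-injective {zero}  {suc j} p = contradiction (≡sym p) (proj₂ (centre-other j))
    centre-injective {suc i} {zero}  p = contradiction p (proj₂ (centre-other i))
    centre-injective {suc i} {suc j} p = cong suc (proj₁ (proj₂ (enumerate others)) p)

    index : ∀ v → type v ≡ hub → ∃ λ i → centre i ≡ v
    index v tv with v Fin.≟ x₁
    ... | yes eq = zero , ≡sym eq
    ... | no neq = let i , eq = proj₂ (proj₂ (proj₂ (enumerate others))) v
                                  (cong₂ _∧_ (≡⇒is tv) (cong not (≢⇒== neq)))
                   in suc i , eq

    part : Fin n → Fin (suc k′)
    part v = proj₁ (index (own v) (own-hub v))

    centre-part : ∀ v → centre (part v) ≡ own v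
    centre-part v = proj₂ (index (own v) (own-hub v))

    part≡ : ∀ {v i} → own v ≡ centre i → part v ≡ i
    part≡ p = centre-injective (trans (centre-part _) p)

    -- The first centre owns all its `Δ` neighbours. A further centre is not the root, since a root
    -- that is a hub is `x₁`; so it owns just its children, one fewer than its degree.
    star-size : (i : Fin (suc k′)) → count (owned (centre i)) ≡ starSize Δ i
    star-size zero    = trans (count-cong owned-x₁) (trans (≡sym (deg≡count G x₁)) (deg-hub (centre-hub zero)))
    star-size (suc i) = trans (count-cong (owned-other tc c≢x₁)) (trans (hub-count tc) (cong (Δ ∸_) (cong ⟦_⟧ (≢⇒nonroot c≢r))))
      where
      c = centre (suc i)
      tc = centre-hub (suc i)
      c≢x₁ = proj₂ (centre-other i)
      c≢r : c ≢ r
      c≢r c≡r with proj₂ (proj₂ first)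
      ... | inj₁ x≡r      = c≢x₁ (trans c≡r (≡sym x≡r))
      ... | inj₂ (¬t , _) = ¬t (trans (cong type (≡sym c≡r)) tc)

    rays : (i : Fin (suc k′)) → ∃ λ (g : Fin (starSize Δ i) → Fin n) → Enumerates (owned (centre i)) g
    rays i = enumerateAs (owned (centre i)) (star-size i)

    star : (i : Fin (suc k′)) → Fin (suc (starSize Δ i)) → Fin n
    star i zero    = centre i
    star i (suc a) = proj₁ (rays i) a

    induced : ∀ i → InducedStar G part i (starSize Δ i) (star i)
    induced i = inj , parts , onto , adjacency
      where
      ray-owned : ∀ a → owned (centre i) (star i (suc a)) ≡ true
      ray-owned = proj₁ (proj₂ (proj₂ (rays i)))
      inj : Injective _≡_ _≡_ (star i)
      inj {zero}  {zero}  _ = refl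
      inj {zero}  {suc b} p = contradiction (≡sym p) (owned⇒≢ (ray-owned b))
      inj {suc a} {zero}  p = contradiction p (owned⇒≢ (ray-owned a))
      inj {suc a} {suc b} p = cong suc (proj₁ (proj₂ (rays i)) p)
      parts : ∀ a → part (star i a) ≡ i
      parts zero    = part≡ (own-self (centre-hub i))
      parts (suc a) = part≡ (owned⇒own (ray-owned a))
      onto : ∀ v → part v ≡ i → ∃ λ a → star i a ≡ v
      onto v eq with v Fin.≟ centre i
      ... | yes p = zero , ≡sym p
      ... | no ¬p = let a , q = proj₂ (proj₂ (proj₂ (rays i))) v
                                  (mk-owned (trans (≡sym (centre-part v)) (cong centre eq)) ¬p)
                    in suc a , q
      adjacency : ∀ a b → adj G (star i a) (star i b) ≡ starAdj a b
      adjacency zero    zero    = irrefl G _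
      adjacency zero    (suc b) = owned⇒adj (ray-owned b)
      adjacency (suc a) zero    = trans (sym G _ _) (owned⇒adj (ray-owned a))
      adjacency (suc a) (suc b) = nonhubs-independent (owned⇒nonhub (ray-owned a)) (owned⇒nonhub (ray-owned b))

    tight⇒family : IsTree G → MaxDegree G Δ → InFamily Δ G
    tight⇒family tree max = tree , max , k′ , part , star , induced
      , (λ i → hub-strong (centre-hub i) , deg-hub (centre-hub i))
      , λ i j → hubs-independent (centre-hub i) (centre-hub j)

-- Timing of the forcing process.

module _ {n} (G : Graph n) (S : Subset n) where

  -- The process in synchronous rounds. Unlike the inductive closure it is visibly decidable, so
  -- every coloured vertex has a first round.
  Coloured-by : ℕ → Fin n → Set
  Coloured-by zero    v = v ∈ S
  Coloured-by (suc t) v = Coloured-by t v ⊎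
    ∃ λ u → Coloured-by t u × Adj G u v × (∀ w → Adj G u w → w ≢ v → Coloured-by t w)

  coloured-by? : ∀ t v → Dec (Coloured-by t v)
  coloured-by? zero    v = v ∈? S
  coloured-by? (suc t) v = coloured-by? t v ⊎-dec Fin.any? λ u →
    coloured-by? t u ×-dec ≡true? (adj G u v) ×-dec
    Fin.all? λ w → ≡true? (adj G u w) →-dec ¬? (w Fin.≟ v) →-dec coloured-by? t w

  coloured-by-mono : ∀ k {t v} → Coloured-by t v → Coloured-by (k + t) v
  coloured-by-mono zero    c = c
  coloured-by-mono (suc k) c = inj₁ (coloured-by-mono k c)

  coloured-by-≤ : ∀ {s t v} → s ≤ t → Coloured-by s v → Coloured-by t v
  coloured-by-≤ {s} {v = v} s≤t c = subst (λ x → Coloured-by x v) (m∸n+n≡m s≤t) (coloured-by-mono _ c)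

  coloured-by : ∀ {v} → Colored G S v → ∃ λ t → Coloured-by t v
  coloured-by (init v∈S)            = 0 , v∈S
  coloured-by (force {u} {v} cu uv cs) =
    -- The sum of all the times is a common bound for the neighbours of `u`.
    suc (t + sum times) , inj₂ (u , coloured-by-≤ (m≤m+n _ _) c , uv , λ w uw w≢v →
      coloured-by-≤ (≤-trans (term≤sum times w) (m≤n+m _ t)) (proj₂ (others w) uw w≢v))
    where
    t = proj₁ (coloured-by cu)
    c = proj₂ (coloured-by cu)
    others : ∀ w → ∃ λ s → Adj G u w → w ≢ v → Coloured-by s w
    others w with ≡true? (adj G u w) | w Fin.≟ v
    ... | yes uw | no w≢v  = let s , cw = coloured-by (cs w uw w≢v) in s , λ _ _ → cw
    -- Vertices for which nothing is claimed get round 0 by default.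
    ... | yes _  | yes w≡v = 0 , λ _ w≢v → contradiction w≡v w≢v
    ... | no ¬uw | _       = 0 , λ uw _ → contradiction uw ¬uw
    times : Fin n → ℕ
    times w = proj₁ (others w)

  -- Keeps from a forcing step the order in which the neighbours of `u` are coloured: `v` comes
  -- strictly last.
  Forces : (Fin n → ℕ) → Fin n → Fin n → Set
  Forces time u v = Adj G u v × (∀ w → Adj G u w → w ≢ v → time w < time v)

  schedule : IsForcingSet G S → ∃ λ time → ∀ v → ¬ v ∈ S → ∃ λ u → Forces time u v
  schedule forcing = time , forcer
    where
    earliest : ∀ v → ∃ λ t → Coloured-by t v × (∀ s → Coloured-by s v → t ≤ s)
    earliest v = let t , c = coloured-by (forcing v) in least (λ s → coloured-by? s v) t c
    time : Fin n → ℕ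
    time v = proj₁ (earliest v)
    forcer : ∀ v → ¬ v ∈ S → ∃ λ u → Forces time u v
    forcer v v∉S with earliest v
    ... | zero  , v∈S , _                     = contradiction v∈S v∉S
    ... | suc t , inj₁ c , min                = contradiction (min t c) 1+n≰n
    ... | suc t , inj₂ (u , _ , uv , cs) , min =
      u , uv , λ w uw w≢v → s≤s (proj₂ (proj₂ (earliest w)) t (cs w uw w≢v))

  -- Two different vertices forced by `u` would each be coloured strictly before the other.
  forces-unique : ∀ {time u v w} → Forces time u v → Forces time u w → v ≡ w
  forces-unique {v = v} {w} (uv , f) (uw , g) with v Fin.≟ w
  ... | yes eq = eq
  ... | no neq = ⊥-elim (<-asym (f w uw (neq ∘ ≡sym)) (g v uv neq))

  leaf-neighbour : ∀ {c a u} → deg G a ≡ 1 → Adj G c a → Adj G a u → u ≡ c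
  leaf-neighbour {c} {a} {u} deg≡1 ca au with u Fin.≟ c
  ... | yes eq = eq
  ... | no neq = contradiction (≤-reflexive (trans (≡sym (deg≡count G a)) deg≡1))
    (<⇒≱ (∃₂⇒count (adj G a) neq au (trans (sym G a c) ca)))

  -- A leaf of `c` in `S` needs a neighbour in `S`, which can only be `c`. If two leaves are outside
  -- `S`, both must be forced by `c`, which can force only one.
  strong-support∈TF : IsTFSet G S → ∀ {c} → StrongSupport G c → c ∈ S
  strong-support∈TF (forcing , total) {c} (a , b , a≢b , ca , cb , deg-a , deg-b) with a ∈? S | b ∈? S
  ... | yes a∈S | _       = let u , u∈S , au = total a a∈S
                            in subst (_∈ S) (leaf-neighbour deg-a ca au) u∈S
  ... | no _    | yes b∈S = let u , u∈S , bu = total b b∈S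
                            in subst (_∈ S) (leaf-neighbour deg-b cb bu) u∈S
  ... | no a∉S  | no b∉S  =
    let _ , forcer = schedule forcing
        u , fa = forcer a a∉S
        w , fb = forcer b b∉S
        u≡c = leaf-neighbour deg-a ca (trans (sym G a u) (proj₁ fa))
        w≡c = leaf-neighbour deg-b cb (trans (sym G b w) (proj₁ fb))
    in contradiction (forces-unique (subst (λ x → Forces _ x a) u≡c fa) (subst (λ x → Forces _ x b) w≡c fb)) a≢b

-- Lower bound for members of the family.

module Converse {n} (G : Graph n) (r : Fin n) (R : Rooted G r) (Δ : ℕ) (1≤Δ : 1 ≤ Δ)
    {k′ : ℕ} (part : Fin n → Fin (suc k′)) (star : (i : Fin (suc k′)) → Fin (suc (starSize Δ i)) → Fin n)
    (induced : ∀ i → InducedStar G part i (starSize Δ i) (star i))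
    (support : ∀ i → StrongSupport G (star i zero) × deg G (star i zero) ≡ Δ)
    (independent : ∀ i j → adj G (star i zero) (star j zero) ≡ false) where
  open Rooted R

  centre : Fin (suc k′) → Fin n
  centre i = star i zero

  centre-injective : ∀ {i j} → centre i ≡ centre j → i ≡ j
  centre-injective {i} {j} eq = trans (≡sym (part-centre i)) (trans (cong part eq) (part-centre j))
    where
    part-centre : ∀ i → part (centre i) ≡ i
    part-centre i = proj₁ (proj₂ (induced i)) zero

  -- The stars partition the vertices; the first has `Δ` plus 1 of them and every other `Δ`.
  order : n ≡ Δ * suc k′ + 1
  order = begin
    n                                              ≡⟨ trans (sum-const n 1) (*-identityʳ n) ⟨
    sum {n} (λ _ → 1)
      ≡⟨ sum-cong-≗ (λ v → ≡sym (count-one (part v ==_) (≡⇒== refl) (λ _ p → ≡sym (==⇒≡ p)))) ⟩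
    sum (λ v → count (λ i → part v == i))          ≡⟨ ∑-comm (λ v i → ⟦ part v == i ⟧) ⟩
    sum (λ i → count (λ v → part v == i))          ≡⟨ sum-cong-≗ star-order ⟩
    sum (λ (i : Fin (suc k′)) → suc (starSize Δ i))                 ≡⟨⟩
    suc Δ + sum {k′} (λ _ → suc (Δ ∸ 1))           ≡⟨ cong (suc Δ +_) (sum-const k′ _) ⟩
    suc Δ + k′ * suc (Δ ∸ 1)                       ≡⟨ cong (λ x → suc Δ + k′ * x) (m+[n∸m]≡n 1≤Δ) ⟩
    suc Δ + k′ * Δ                                 ≡⟨ shuffle Δ k′ ⟩
    Δ * suc k′ + 1                                 ∎
    where
    open ≡-Reasoning
    shuffle : ∀ d k → suc d + k * d ≡ d * suc k + 1
    shuffle = solve-∀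
    star-order : ∀ i → count (λ v → part v == i) ≡ suc (starSize Δ i)
    star-order i = let inj , parts , onto , _ = induced i in count-enumerated (λ v → part v == i)
      (inj , (λ a → ≡⇒== (parts a)) , λ v p → onto v (==⇒≡ p))

  -- The edge from w to its parent is incident with the i-th centre.
  covers : Fin (suc k′) → Fin n → Bool
  covers i w = nonroot w ∧ ((par w == centre i) ∨ (w == centre i))

  -- Edges are indexed by their lower ends, so those at a centre are the edges to its children and,
  -- away from the root, its own parent edge.
  count-covers : ∀ i → count (covers i) ≡ Δ
  count-covers i = begin
    count (covers i)                                  ≡⟨ sum-cong-≗ split ⟩
    sum (λ w → ⟦ child c w ⟧ + ⟦ nonroot w ∧ (w == c) ⟧) ≡⟨ ∑-distrib-+ (λ w → ⟦ child c w ⟧) _ ⟩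
    count (child c) + count (λ w → nonroot w ∧ (w == c)) ≡⟨ cong (count (child c) +_) only ⟩
    count (child c) + ⟦ nonroot c ⟧                     ≡⟨ deg≡children c ⟨
    deg G c                                           ≡⟨ proj₂ (support i) ⟩
    Δ                                                 ∎
    where
    open ≡-Reasoning
    c = centre i
    split : ∀ w → ⟦ covers i w ⟧ ≡ ⟦ child c w ⟧ + ⟦ nonroot w ∧ (w == c) ⟧
    split w with nonroot w in nr | par w == c in p | w == c in q
    ... | false | _     | _     = refl
    ... | true  | false | _     = refl
    ... | true  | true  | false = refl
    ... | true  | true  | true  = ⊥-elim (<-irrefl (cong rank (trans (==⇒≡ p) (≡sym (==⇒≡ q))))
      (par-rank w (nonroot⇒≢ nr)))
    only : count (λ w → nonroot w ∧ (w == c)) ≡ ⟦ nonroot c ⟧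
    only = trans (sum-single (λ w → ⟦ nonroot w ∧ (w == c) ⟧) c
        (λ w w≢c → cong ⟦_⟧ (trans (cong (nonroot w ∧_) (≢⇒== w≢c)) (Bool.∧-zeroʳ _))))
      (cong ⟦_⟧ (trans (cong (nonroot c ∧_) (≡⇒== {v = c} refl)) (Bool.∧-identityʳ _)))

  -- An edge with two centres on it would join them, against independence.
  covered-once : ∀ w → count (λ i → covers i w) ≤ ⟦ nonroot w ⟧
  covered-once w with nonroot w in nr
  ... | false = ≤-reflexive (count-none {n = suc k′} (λ _ → false) (λ _ → refl))
  ... | true  = count-≤1 (λ i → (par w == centre i) ∨ (w == centre i)) unique
    where
    w≢r = nonroot⇒≢ nr
    apart : ∀ i j → par w ≡ centre i → w ≡ centre j → ⊥
    apart i j p q = true≢false (subst₂ (Adj G) p q (par-adj w w≢r)) (independent i j)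
    unique : ∀ i j → ((par w == centre i) ∨ (w == centre i)) ≡ true →
      ((par w == centre j) ∨ (w == centre j)) ≡ true → i ≡ j
    unique i j p q with ∨-true {par w == centre i} p | ∨-true {par w == centre j} q
    ... | inj₁ p | inj₁ q = centre-injective (trans (≡sym (==⇒≡ p)) (==⇒≡ q))
    ... | inj₂ p | inj₂ q = centre-injective (trans (≡sym (==⇒≡ p)) (==⇒≡ q))
    ... | inj₁ p | inj₂ q = ⊥-elim (apart i j (==⇒≡ p) (==⇒≡ q))
    ... | inj₂ p | inj₁ q = ⊥-elim (apart j i (==⇒≡ q) (==⇒≡ p))

  -- Independent centres of degree Δ meet Δ (k′ + 1) = n − 1 edges, that is, all of them.
  covered : ∀ w → count (λ i → covers i w) ≡ ⟦ nonroot w ⟧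
  covered = sum-tight covered-once (≤-reflexive (begin
    count nonroot                                ≡⟨ +-cancelʳ-≡ 1 _ _ (trans count-nonroot order) ⟩
    Δ * suc k′                                   ≡⟨ *-comm Δ (suc k′) ⟩
    suc k′ * Δ                                   ≡⟨ sum-const (suc k′) Δ ⟨
    sum {suc k′} (λ _ → Δ)                       ≡⟨ sum-cong-≗ (λ i → ≡sym (count-covers i)) ⟩
    sum (λ i → count (covers i))                 ≡⟨ ∑-comm (λ i w → ⟦ covers i w ⟧) ⟩
    sum (λ w → count (λ i → covers i w))         ∎))
    where open ≡-Reasoning

  centre-on-child-edge : ∀ {u v} → child u v ≡ true → (∃ λ i → centre i ≡ u) ⊎ (∃ λ i → centre i ≡ v)
  centre-on-child-edge {u} {v} c with count⇒∃ (λ i → covers i v)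
    (≤-reflexive (≡sym (trans (covered v) (cong ⟦_⟧ (≢⇒nonroot (child⇒≢r c))))))
  ... | i , p with ∨-true {par v == centre i} (proj₂ (∧-true {nonroot v} p))
  ...   | inj₁ q = inj₁ (i , trans (≡sym (==⇒≡ q)) (child⇒par c))
  ...   | inj₂ q = inj₂ (i , ≡sym (==⇒≡ q))

  centre-on-edge : ∀ {u v} → Adj G u v → (∃ λ i → centre i ≡ u) ⊎ (∃ λ i → centre i ≡ v)
  centre-on-edge uv with adj⇒child uv
  ... | inj₁ c = centre-on-child-edge c
  ... | inj₂ c = swap (centre-on-child-edge c)

  uncoloured : Subset n → Fin n → Bool
  uncoloured S v = not (lookup S v)

  uncoloured⇒∉ : ∀ {S v} → uncoloured S v ≡ true → ¬ v ∈ S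
  uncoloured⇒∉ p v∈S = true≢false p (cong not ([]=⇒lookup v∈S))

  -- Every edge at a vertex outside S has its other end at a centre, so centres do all the forcing.
  few-uncoloured : ∀ {S} → IsTFSet G S → count (uncoloured S) ≤ suc k′
  few-uncoloured {S} tf = count-injection (uncoloured S) (λ v p → proj₁ (forcing-centre v (uncoloured⇒∉ p)))
    λ v w p q eq → forces-unique G S (proj₂ (forcing-centre v (uncoloured⇒∉ p)))
      (subst (λ i → Forces G S time (centre i) w) (≡sym eq) (proj₂ (forcing-centre w (uncoloured⇒∉ q))))
    where
    time = proj₁ (schedule G S (proj₁ tf))
    forcing-centre : ∀ v → ¬ v ∈ S → ∃ λ i → Forces G S time (centre i) v
    forcing-centre v v∉S with proj₂ (schedule G S (proj₁ tf)) v v∉S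
    ... | u , f with centre-on-edge (proj₁ f)
    ...   | inj₁ (i , eq) = i , subst (λ x → Forces G S time x v) (≡sym eq) f
    ...   | inj₂ (i , eq) = contradiction
      (subst (_∈ S) eq (strong-support∈TF G S tf (proj₁ (support i)))) v∉S

  -- At most `suc k′` vertices lie outside `S`, and `Δ * suc k′` is `n` minus 1 by `order`.
  lower-bound : ∀ {S} → IsTFSet G S → (Δ ∸ 1) * n + 1 ≤ Δ * ∣ S ∣
  lower-bound {S} tf = +-cancelʳ-≤ (Δ * suc k′) _ _ (begin
    (Δ ∸ 1) * n + 1 + Δ * suc k′    ≡⟨ shuffle ((Δ ∸ 1) * n) (Δ * suc k′) ⟩
    (Δ * suc k′ + 1) + (Δ ∸ 1) * n  ≡⟨ cong (_+ (Δ ∸ 1) * n) (≡sym order) ⟩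
    suc (Δ ∸ 1) * n                 ≡⟨ cong (_* n) (m+[n∸m]≡n 1≤Δ) ⟩
    Δ * n                           ≡⟨ cong (Δ *_) (≡sym split) ⟩
    Δ * (∣ S ∣ + count (uncoloured S)) ≡⟨ *-distribˡ-+ Δ ∣ S ∣ _ ⟩
    Δ * ∣ S ∣ + Δ * count (uncoloured S) ≤⟨ +-monoʳ-≤ _ (*-monoʳ-≤ Δ (few-uncoloured tf)) ⟩
    Δ * ∣ S ∣ + Δ * suc k′          ∎)
    where
    open ≤-Reasoning
    shuffle : ∀ x y → x + 1 + y ≡ y + 1 + x
    shuffle = solve-∀
    split : ∣ S ∣ + count (uncoloured S) ≡ n
    split = trans (+-comm ∣ S ∣ _) (trans (cong (count (uncoloured S) +_)
      (trans (cong ∣_∣ (≡sym (tabulate∘lookup S))) (∣tabulate∣ (lookup S)))) (count-not (lookup S)))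

-- The degenerate degrees, and assembly of both directions.

-- A parent other than the root has degree at least 2. So if all degrees were at most 1, every
-- vertex would be the root or its child, which leaves at most two vertices.
max-degree-≥2 : ∀ {n} {G : Graph n} {r} → n ≥ 3 → Rooted G r → ∀ Δ → (∀ v → deg G v ≤ Δ) → 2 ≤ Δ
max-degree-≥2 {n} {G} {r} n≥3 R Δ deg≤Δ with 2 ≤? Δ
... | yes 2≤Δ = 2≤Δ
... | no ¬2≤Δ = contradiction n≥3 (<⇒≱ (s≤s (begin
    n                       ≡⟨ count-nonroot ⟨
    count nonroot + 1       ≤⟨ +-monoˡ-≤ 1 (sum-mono root-child) ⟩
    count (child r) + 1     ≤⟨ +-monoˡ-≤ 1 (≤-trans (m≤m+n _ _) (≤-reflexive (≡sym (deg≡children r)))) ⟩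
    deg G r + 1             ≤⟨ +-monoˡ-≤ 1 (deg≤1 r) ⟩
    2                       ∎)))
  where
  open Rooted R
  open ≤-Reasoning
  deg≤1 : ∀ v → deg G v ≤ 1
  deg≤1 v = ≤-trans (deg≤Δ v) (≤-pred (≰⇒> ¬2≤Δ))
  root-child : ∀ w → ⟦ nonroot w ⟧ ≤ ⟦ child r w ⟧
  root-child w with nonroot w in nr | par w Fin.≟ r
  ... | false | _     = z≤n
  ... | true  | yes p = ≤-reflexive (≡sym (cong ⟦_⟧ (≡⇒== p)))
  ... | true  | no p≢r = contradiction (deg≤1 (par w)) (<⇒≱ (subst (2 ≤_) (≡sym (deg≡children (par w)))
    (+-mono-≤ (count-≥1 (child (par w)) (par-child (nonroot⇒≢ nr)))
      (≤-reflexive (≡sym (cong ⟦_⟧ (≢⇒nonroot p≢r)))))))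

theorem3 : (n : ℕ) → n ≥ 3 → (T : Graph n) → IsTree T →
    (Δ : ℕ) → MaxDegree T Δ → (k : ℕ) → IsTotalForcingNumber T k →
    (Δ * k ≤ (Δ ∸ 1) * n + 1)
    × ((Δ * k ≡ (Δ ∸ 1) * n + 1) ⇔ InFamily Δ T)
theorem3 n n≥3 T tree Δ max@((r , deg-r) , deg≤Δ) k ((S₀ , tf₀ , ∣S₀∣≡k) , minimal) =
  upper , mk⇔ to from
  where
  R : Rooted T r
  R = root-tree T r tree

  2≤Δ : 2 ≤ Δ
  2≤Δ = max-degree-≥2 n≥3 R Δ deg≤Δ

  open Construction T r R Δ 2≤Δ deg≤Δ deg-r using (Bound; tight-or-improvable)

  use-bound : ∀ {e} → Bound e → Δ * k + e ≤ (Δ ∸ 1) * n + 1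
  use-bound {e} (S , tf , le) = ≤-trans (+-monoˡ-≤ e (*-monoʳ-≤ Δ (minimal S tf))) le

  upper : Δ * k ≤ (Δ ∸ 1) * n + 1
  upper with tight-or-improvable
  ... | inj₁ (_ , b) = m+n≤o⇒m≤o (Δ * k) (use-bound b)
  ... | inj₂ b       = m+n≤o⇒m≤o (Δ * k) (use-bound b)

  to : Δ * k ≡ (Δ ∸ 1) * n + 1 → InFamily Δ T
  to eq with tight-or-improvable
  ... | inj₁ (t , _) = Family.tight⇒family T r R Δ 2≤Δ deg≤Δ deg-r t tree max
  -- A total forcing set with margin 1 makes the bound on `k` strict, against the assumed equality.
  ... | inj₂ b       = contradiction (use-bound b)
    (<⇒≱ (≤-reflexive (trans (cong suc (≡sym eq)) (≡sym (+-comm (Δ * k) 1)))))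

  from : InFamily Δ T → Δ * k ≡ (Δ ∸ 1) * n + 1
  from (_ , _ , _ , part , star , induced , support , independent) =
    ≤-antisym upper (subst (λ s → (Δ ∸ 1) * n + 1 ≤ Δ * s) ∣S₀∣≡k
      (Converse.lower-bound T r R Δ (≤-trans (n≤1+n 1) 2≤Δ) part star induced support independent tf₀))
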